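{- Let $n, k, d$ be positive integers satisfying $k > d \ge 2$ and $n \ge 2k+2d-3$. Then every intersecting family $\mathcal{F}$ of $k$-subsets of $[n]$ satisfies $$\delta_d(\mathcal{F})\le \binom{n-d-1}{k-d-1}.$$
   Context: $[n]=\{1,2,\dots,n\}$ and $\binom{[n]}{k}$ is the family of all $k$-element subsets of $[n]$. A family $\mathcal{F}\subset\binom{[n]}{k}$ is intersecting if $A\cap B\neq\emptyset$ for all $A,B\in\mathcal{F}$. For $S\subset[n]$, the $S$-degree of $\mathcal{F}$ is $d_S(\mathcal{F})=|\{T: S\subset T\in\mathcal{F}\}|$. For $0\le d\le k$, the minimum $d$-degree $\delta_d(\mathcal{F})$ is the minimum of $d_S(\mathcal{F})$ over all $S\subset[n]$ with $|S|=d$. -}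

module Defs where

open import Data.Bool.Properties using () renaming (_≟_ to _≟ᵇ_)
open import Data.Fin.Subset using (Subset; Side; inside; outside; _⊆_; _∩_; ∣_∣; Nonempty)
open import Data.Fin.Subset.Properties using (_⊆?_)
open import Data.List.Base using (List; []; _∷_; _++_; map; filter; length)
open import Data.List.Extrema.Nat using (min)
open import Data.Nat.Base using (ℕ; zero; suc)
open import Data.Nat.Properties using (_≟_)
import Data.Vec.Base as Vec
open import Relation.Binary.PropositionalEquality.Core using (_≡_)
open import Relation.Nullary.Decidable using (Dec; _×-dec_)

-- As Subset n is a Boolean vector indexed by Fin n, a family of subsets is a
-- Boolean-valued characteristic function on Subset n.
Family : ℕ → Set
Family n = Subset n → Side

infix 4 _∈ᶠ_ _∈ᶠ?_

_∈ᶠ_ : ∀ {n} → Subset n → Family n → Set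
T ∈ᶠ F = F T ≡ inside

_∈ᶠ?_ : ∀ {n} (T : Subset n) (F : Family n) → Dec (T ∈ᶠ F)
T ∈ᶠ? F = F T ≟ᵇ inside

Uniform : ∀ {n} → ℕ → Family n → Set
Uniform k F = ∀ T → T ∈ᶠ F → ∣ T ∣ ≡ k

Intersecting : ∀ {n} → Family n → Set
Intersecting F = ∀ A B → A ∈ᶠ F → B ∈ᶠ F → Nonempty (A ∩ B)

-- Every subset of Fin n occurs exactly once, so lengths of filtered sublists
-- are cardinalities.
subsets : ∀ n → List (Subset n)
subsets zero    = Vec.[] ∷ []
subsets (suc n) = map (outside Vec.∷_) (subsets n) ++ map (inside Vec.∷_) (subsets n)

size : ∀ {n} → Family n → ℕ
size F = length (filter (_∈ᶠ? F) (subsets _))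

degree : ∀ {n} → Family n → Subset n → ℕ
degree F S = length (filter (λ T → (S ⊆? T) ×-dec (T ∈ᶠ? F)) (subsets _))

-- The library's min takes a starting value as its first argument.  Since
-- degree F S ≤ size F for every S, starting from size F does not change the
-- minimum whenever d ≤ n; for d > n there is no S and the value is a convention.
δ : ∀ {n} → ℕ → Family n → ℕ
δ d F = min (size F) (map (degree F) (filter (λ S → ∣ S ∣ ≟ d) (subsets _)))

{-# OPTIONS --safe #-}
-- Let f be the characteristic function of F, m = |F|, and Z the disjointness
-- operator.  Counting pairs (D, B) with |D| = d, B ∈ F, D ∩ B = ∅ gives
--   δ (n-k choose d) m ≤ ∑_D deg(D) (Z f)(D) = ∑_{A,B ∈ F} (|A \ B| choose d),
-- with equality for a star, while ⟨f, Z f⟩ = 0 because F is intersecting.  So it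
-- suffices that the quadratic form
--   (n-d-1 choose k-d-1) (n-k choose d) ⟨f, f⟩ - ∑_D deg(D) (Z f)(D) + y ⟨f, Z f⟩
-- is positive semidefinite on functions on k-sets.  Here y is chosen such that
-- the form vanishes on the two eigenspaces of the Johnson scheme which carry the
-- stars.  All the operators are diagonalised simultaneously by writing
-- f(B) = ∑_{A ⊆ B} h(A) with h harmonic, that is, ∑_{x ∉ S} h(S ∪ {x}) = 0 for all
-- S; the form then becomes ∑_S (eigenvalue at |S|) h(S)² up to a positive factor.
-- The s-th eigenvalue is proportional to k - d + (-1)^s (g_s(k) - g_s(d)), where
-- g_s(x) = x (x-1) … (x-s+1) / ((n-x-1) … (n-x-s+1)).  For s = 0, 1
-- it is 0, for even s ≥ 2 it is positive as g_s(k) ≥ g_s(d), and for odd s it is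
-- nonnegative by induction since g_s(k) - g_{s+2}(k) ≥ g_s(d) - g_{s+2}(d).
module Submission where

open import Defs
open import Data.Bool.Base using (Bool; true; false; _∧_)
open import Data.Fin.Base using (suc)
open import Data.Fin.Subset using (Subset; outside; inside; ∣_∣; _∩_; Empty)
open import Data.Fin.Subset.Properties using (∣p∣≤n; _⊆?_; drop-there)
open import Data.Integer.Base as ℤ using (ℤ; 0ℤ; 1ℤ; -1ℤ)
import Data.Integer.Properties as ℤ
import Data.Integer.Tactic.RingSolver as ℤ-Solver
open import Algebra.Properties.AbelianGroup ℤ.+-0-abelianGroup using (∙-cancelʳ)
open import Data.List.Base using ([]; _∷_; _++_; length; filter; map)
open import Data.List.Extrema.Nat using (min≤⊤; min≤v⁺)
open import Data.List.Membership.Propositional using (_∈_; lose)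
open import Data.List.Membership.Propositional.Properties using (∈-map⁺; ∈-++⁺ˡ; ∈-++⁺ʳ; ∈-filter⁺)
open import Data.List.Properties using (filter-++; length-++)
open import Data.List.Relation.Unary.Any using (here)
open import Data.Nat.Base as ℕ using (ℕ; zero; suc; z≤n; s≤s; _!; NonZero)
open import Data.Nat.Combinatorics using (nCk≡nC[n∸k]; nCk+nC[k+1]≡[n+1]C[k+1])
open import Data.Nat.Divisibility using (∣-trans; divides; m≤n⇒m!∣n!)
open import Data.Nat.DivMod using (_/_; m*[n/m]≡n)
import Data.Nat.Properties as ℕ
import Data.Nat.Tactic.RingSolver as ℕ-Solver
open import Data.Product.Base using (∃-syntax; _×_; _,_)
open import Data.Sum.Base using (_⊎_; inj₁; inj₂)
open import Data.Vec.Base using ([]; _∷_)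
open import Function.Base using (_∘_)
open import Relation.Binary.Definitions using (tri<; tri≈; tri>)
open import Relation.Binary.PropositionalEquality
open import Relation.Nullary.Decidable using (yes; no; does; _×-dec_)
open import Relation.Nullary.Negation using (contradiction)
open import Relation.Unary using (Decidable)

-- Identities for binomial coefficients.

module _ where

  open import Data.Nat.Base
  open import Data.Nat.Combinatorics using (_C_)
  open import Data.Nat.Properties
  open import Data.Nat.Tactic.RingSolver using (solve-∀)

  sgn : ℕ → ℤ
  sgn zero    = 1ℤ
  sgn (suc s) = ℤ.- sgn s

  -- The number of ways to complete an s-set to a k-set with elements of a
  -- given m-set: β m k s is the binomial coefficient m C (k - s), and 0 if s > k.
  β : ℕ → ℕ → ℕ → ℕ
  β m k       zero    = m C k
  β m zero    (suc s) = 0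
  β m (suc k) (suc s) = β m k s

  β-C : ∀ m {k s} → s ≤ k → β m k s ≡ m C (k ∸ s)
  β-C m z≤n       = refl
  β-C m (s≤s s≤k) = β-C m s≤k

  β-0 : ∀ m {k s} → k < s → β m k s ≡ 0
  β-0 m {zero}  (s≤s _)   = refl
  β-0 m {suc k} (s≤s k<s) = β-0 m k<s

  β-pascal : ∀ m k s → β (suc m) k s ≡ β m k s + β m k (suc s)
  β-pascal m zero    zero    = refl
  β-pascal m (suc k) zero    =
    trans (sym (nCk+nC[k+1]≡[n+1]C[k+1] m k)) (+-comm (m C k) (m C suc k))
  β-pascal m zero    (suc s) = refl
  β-pascal m (suc k) (suc s) = β-pascal m k s

  C-absorption : ∀ m k → suc k * (suc m C suc k) ≡ suc m * (m C k)
  C-absorption zero    zero    = refl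
  C-absorption zero    (suc k) = *-zeroʳ k
  C-absorption (suc m) zero    = begin
    1 * (suc (suc m) C 1)  ≡⟨ *-identityˡ (suc (suc m) C 1) ⟩
    suc (suc m) C 1          ≡⟨ nCk+nC[k+1]≡[n+1]C[k+1] (suc m) 0 ⟨
    1 + (suc m C 1)        ≡⟨ cong suc (sym (*-identityˡ (suc m C 1))) ⟩
    1 + 1 * (suc m C 1)  ≡⟨ cong suc (C-absorption m zero) ⟩
    1 + suc m * 1        ∎
    where open ≡-Reasoning
  C-absorption (suc m) (suc k) = begin
    suc (suc k) * (suc (suc m) C suc (suc k))
      ≡⟨ cong (suc (suc k) *_) (nCk+nC[k+1]≡[n+1]C[k+1] (suc m) (suc k)) ⟨
    suc (suc k) * ((suc m C suc k) + (suc m C suc (suc k)))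
      ≡⟨ r₁ k (suc m C suc k) (suc m C suc (suc k)) ⟩
    suc k * (suc m C suc k) + (suc m C suc k) + suc (suc k) * (suc m C suc (suc k))
      ≡⟨ cong₂ (λ x y → x + (suc m C suc k) + y) (C-absorption m k) (C-absorption m (suc k)) ⟩
    suc m * (m C k) + (suc m C suc k) + suc m * (m C suc k)
      ≡⟨ r₂ m (m C k) (m C suc k) (suc m C suc k) ⟩
    suc m * ((m C k) + (m C suc k)) + (suc m C suc k)
      ≡⟨ cong (λ x → suc m * x + (suc m C suc k)) (nCk+nC[k+1]≡[n+1]C[k+1] m k) ⟩
    suc m * (suc m C suc k) + (suc m C suc k)
      ≡⟨ +-comm (suc m * (suc m C suc k)) (suc m C suc k) ⟩
    suc (suc m) * (suc m C suc k) ∎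
    where
    open ≡-Reasoning
    r₁ : ∀ k a b → suc (suc k) * (a + b) ≡ suc k * a + a + suc (suc k) * b
    r₁ = solve-∀
    r₂ : ∀ m a b c → suc m * a + c + suc m * b ≡ suc m * (a + b) + c
    r₂ = solve-∀

  C-sym : ∀ m e → (m + e) C e ≡ (m + e) C m
  C-sym m e = trans (nCk≡nC[n∸k] (m≤n+m e m)) (cong ((m + e) C_) (m+n∸n≡m m e))

  C-absorptionʳ : ∀ m e → suc m * (suc (m + e) C e) ≡ suc (m + e) * ((m + e) C e)
  C-absorptionʳ m e = begin
    suc m * (suc (m + e) C e)          ≡⟨ cong (suc m *_) (C-sym (suc m) e) ⟩
    suc m * (suc (m + e) C suc m)      ≡⟨ C-absorption (m + e) m ⟩
    suc (m + e) * ((m + e) C m)        ≡⟨ cong (suc (m + e) *_) (C-sym m e) ⟨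
    suc (m + e) * ((m + e) C e)        ∎
    where open ≡-Reasoning

  -- Both sides equal (m + e + 1) times `(m + e) C e`.
  C-adjacent : ∀ m e → suc m * ((m + suc e) C e) ≡ suc e * ((m + suc e) C suc e)
  C-adjacent m e rewrite +-suc m e = trans (C-absorptionʳ m e) (sym (C-absorption (m + e) e))

  -- Both sides are the multinomial coefficient (m + p + q)! / (m! p! q!).
  C-exchange : ∀ m p q → ((m + p + q) C p) * ((m + q) C q) ≡ ((m + p + q) C q) * ((m + p) C p)
  C-exchange m zero    q rewrite +-identityʳ m = *-comm 1 ((m + q) C q)
  C-exchange m (suc p) q = *-cancelˡ-≡ _ _ (suc p) (begin
    suc p * (((m + suc p + q) C suc p) * ((m + q) C q))
      ≡⟨ cong (λ x → suc p * ((x C suc p) * ((m + q) C q))) (cong (_+ q) (+-suc m p)) ⟩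
    suc p * ((suc (m + p + q) C suc p) * ((m + q) C q))
      ≡⟨ *-assoc (suc p) (suc (m + p + q) C suc p) ((m + q) C q) ⟨
    suc p * (suc (m + p + q) C suc p) * ((m + q) C q)
      ≡⟨ cong (_* ((m + q) C q)) (C-absorption (m + p + q) p) ⟩
    suc (m + p + q) * ((m + p + q) C p) * ((m + q) C q)
      ≡⟨ *-assoc (suc (m + p + q)) ((m + p + q) C p) ((m + q) C q) ⟩
    suc (m + p + q) * (((m + p + q) C p) * ((m + q) C q))
      ≡⟨ cong (suc (m + p + q) *_) (C-exchange m p q) ⟩
    suc (m + p + q) * (((m + p + q) C q) * ((m + p) C p))
      ≡⟨ *-assoc (suc (m + p + q)) ((m + p + q) C q) ((m + p) C p) ⟨
    suc (m + p + q) * ((m + p + q) C q) * ((m + p) C p)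
      ≡⟨ cong (_* ((m + p) C p)) (C-absorptionʳ (m + p) q) ⟨
    suc (m + p) * (suc (m + p + q) C q) * ((m + p) C p)
      ≡⟨ swap (suc (m + p)) (suc (m + p + q) C q) ((m + p) C p) ⟩
    (suc (m + p + q) C q) * (suc (m + p) * ((m + p) C p))
      ≡⟨ cong ((suc (m + p + q) C q) *_) (C-absorption (m + p) p) ⟨
    (suc (m + p + q) C q) * (suc p * (suc (m + p) C suc p))
      ≡⟨ swap′ (suc (m + p + q) C q) (suc p) (suc (m + p) C suc p) ⟩
    suc p * ((suc (m + p + q) C q) * (suc (m + p) C suc p))
      ≡⟨ cong (λ x → suc p * (((x + q) C q) * (x C suc p))) (+-suc m p) ⟨
    suc p * (((m + suc p + q) C q) * ((m + suc p) C suc p)) ∎)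
    where
    open ≡-Reasoning
    swap : ∀ a b c → a * b * c ≡ b * (a * c)
    swap = solve-∀
    swap′ : ∀ a b c → a * (b * c) ≡ b * (a * c)
    swap′ = solve-∀

  C>0 : ∀ m e → 0 < (m + e) C e
  C>0 m zero    = s≤s z≤n
  C>0 m (suc e) = *-cancelˡ-< (suc e) 0 _ (≤-trans (≤-reflexive (cong suc (*-zeroʳ e)))
    (≤-trans (*-mono-< {0} {suc m} {0} {(m + suc e) C e} (s≤s z≤n) (subst (λ x → 0 < x C e) (sym (+-suc m e)) (C>0 (suc m) e)))
             (≤-reflexive (C-adjacent m e))))

  -- This is `C-exchange` with q = i + e, times `v C e`. The tops u, v, w are variables with
  -- equations so that truncated differences can be put in their place.
  C-exchange′ : ∀ {u v w} i e m → u ≡ m + i + (i + e) → v ≡ m + (i + e) → w ≡ m + i →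
    (u C i) * (v C e) * (v C (i + e)) ≡ (u C (i + e)) * ((w C i) * (v C e))
  C-exchange′ i e m refl refl refl = begin
    (u C i) * (v C e) * (v C (i + e))      ≡⟨ swap (u C i) (v C e) (v C (i + e)) ⟩
    (u C i) * (v C (i + e)) * (v C e)      ≡⟨ cong (_* (v C e)) (C-exchange m i (i + e)) ⟩
    (u C (i + e)) * ((m + i) C i) * (v C e)  ≡⟨ *-assoc (u C (i + e)) ((m + i) C i) (v C e) ⟩
    (u C (i + e)) * (((m + i) C i) * (v C e)) ∎
    where
    open ≡-Reasoning
    u v : ℕ
    u = m + i + (i + e)
    v = m + (i + e)
    swap : ∀ x y z → x * y * z ≡ x * z * y
    swap = solve-∀

  ∸-unique : ∀ {n} i {j} → n ≡ i + j → n ∸ i ≡ j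
  ∸-unique i {j} refl = m+n∸m≡n i j

  ∸-pred : ∀ n m → suc m ≤ n → n ∸ m ≡ suc (n ∸ suc m)
  ∸-pred n m = +-∸-assoc 1

  sgn-cases : ∀ s → sgn s ≡ 1ℤ ⊎ sgn s ≡ -1ℤ
  sgn-cases zero = inj₁ refl
  sgn-cases (suc s) with sgn-cases s
  ... | inj₁ eq = inj₂ (cong ℤ.-_ eq)
  ... | inj₂ eq = inj₁ (cong ℤ.-_ eq)

  -- The eigenvalues and their nonnegativity.

  module Coefficients (n k d : ℕ) (d<k : d < k) (2≤d : 2 ≤ d) (bound : 2 * k + 2 * d ≤ 3 + n) where

    -- c ⟨f, f⟩ - L₀ ∑_D deg(D) (Z f)(D) + L ⟨f, Z f⟩ is the form of the header
    -- multiplied by L₀, and (-1)^s (a s) and (-1)^s (b s) are the eigenvalues of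
    -- L ⟨f, Z f⟩ and L₀ ∑_D deg(D) (Z f)(D) for the part of f coming from level s.
    L₀ L c : ℕ
    L₀ = (n ∸ k) C k
    L  = ((n ∸ k) C d) * ((n ∸ suc d) C (k ∸ d))
    c  = L₀ * (((n ∸ k) C d) * ((n ∸ suc d) C (k ∸ suc d)))

    a b p q : ℕ → ℕ
    a s = L * β (n ∸ (k + s)) k s
    b s = L₀ * (β (n ∸ (k + s)) d s * ((n ∸ (d + s)) C (k ∸ d)))
    p s = n ∸ (k + s)
    q s = n ∸ (d + s)

    -- Makes the truncated differences `p s` and `q s` genuine and positive for s ≤ k, so that they
    -- may be cancelled.
    2k<n : k + k < n
    2k<n = +-cancelˡ-≤ 3 (suc (k + k)) n (begin
      3 + suc (k + k)            ≡⟨ r k ⟩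
      2 * k + 2 * 2              ≤⟨ +-monoʳ-≤ (2 * k) (*-monoʳ-≤ 2 2≤d) ⟩
      2 * k + 2 * d              ≤⟨ bound ⟩
      3 + n                      ∎)
      where
      open ≤-Reasoning
      r : ∀ k → 3 + suc (k + k) ≡ 2 * k + 2 * 2
      r = solve-∀

    p≤q : ∀ s → p s ≤ q s
    p≤q s = ∸-monoʳ-≤ n (+-monoˡ-≤ s (<⇒≤ d<k))

    p-suc : ∀ s → s < k → p s ≡ suc (p (suc s))
    p-suc s s<k = trans (∸-pred n (k + s) (<-trans (+-monoʳ-< k s<k) 2k<n)) (cong (λ x → suc (n ∸ x)) (sym (+-suc k s)))

    q-suc : ∀ s → s < k → q s ≡ suc (q (suc s))
    q-suc s s<k = trans (∸-pred n (d + s) (<-trans (+-mono-< d<k s<k) 2k<n)) (cong (λ x → suc (n ∸ x)) (sym (+-suc d s)))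

    p>0 : ∀ s → s < k → NonZero (p s)
    p>0 s s<k rewrite p-suc s s<k = _

    q>0 : ∀ s → s < k → NonZero (q s)
    q>0 s s<k rewrite q-suc s s<k = _

    β-step : ∀ m {l s} → s < l → suc m * β m l (suc s) ≡ (l ∸ s) * β (suc m) l s
    β-step m {suc l} {s} (s≤s s≤l) rewrite β-C m s≤l | β-C (suc m) (m≤n⇒m≤1+n s≤l) | +-∸-assoc 1 s≤l =
      sym (C-absorption m (l ∸ s))

    -- Together with `b-step`, `b₀-a₀` and `c-a₀` this shows that, for s ≤ k, the numbers `a s`,
    -- `b s` and `c` are g_s(k), g_s(d) and k - d times the common factor a 0 / p 0. The recursions
    -- are kept in multiplied form to stay within the natural numbers.
    a-step : ∀ s → s < k → p s * a (suc s) ≡ (k ∸ s) * a s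
    a-step s s<k rewrite p-suc s s<k = begin
      suc m * (L * β m k (suc s))             ≡⟨ swap (suc m) L (β m k (suc s)) ⟩
      L * (suc m * β m k (suc s))             ≡⟨ cong (L *_) (β-step m s<k) ⟩
      L * ((k ∸ s) * β (suc m) k s)           ≡⟨ swap L (k ∸ s) (β (suc m) k s) ⟩
      (k ∸ s) * (L * β (suc m) k s)           ∎
      where
      open ≡-Reasoning
      m = p (suc s)
      swap : ∀ a b c → a * (b * c) ≡ b * (a * c)
      swap = solve-∀

    q≡p+e : ∀ s → s ≤ k → q s ≡ p s + (k ∸ d)
    q≡p+e s s≤k = +-cancelˡ-≡ (d + s) (q s) (p s + (k ∸ d)) (begin
      d + s + q s                          ≡⟨ m+[n∸m]≡n (<⇒≤ (<-≤-trans (+-mono-<-≤ d<k s≤k) (<⇒≤ 2k<n))) ⟩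
      n                                    ≡⟨ m+[n∸m]≡n (<⇒≤ (≤-<-trans (+-monoʳ-≤ k s≤k) 2k<n)) ⟨
      k + s + p s                          ≡⟨ cong (λ x → x + s + p s) (m+[n∸m]≡n (<⇒≤ d<k)) ⟨
      d + (k ∸ d) + s + p s                ≡⟨ r d (k ∸ d) s (p s) ⟩
      d + s + (p s + (k ∸ d))              ∎)
      where
      open ≡-Reasoning
      r : ∀ d e s p → d + e + s + p ≡ d + s + (p + e)
      r = solve-∀

    C-step : ∀ s → s < k → p s * (q s C (k ∸ d)) ≡ q s * (q (suc s) C (k ∸ d))
    C-step s s<k rewrite p-suc s s<k | q-suc s s<k | q≡p+e (suc s) s<k = C-absorptionʳ (p (suc s)) (k ∸ d)

    b-0 : ∀ {s} → d < s → b s ≡ 0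
    b-0 {s} d<s rewrite β-0 (p s) d<s = *-zeroʳ L₀

    b-step : ∀ s → s < k → q s * b (suc s) ≡ (d ∸ s) * b s
    b-step s s<k with ≤-<-connex d s
    -- Both sides vanish: `b` is zero beyond level d, and `d ∸ s` is truncated to 0.
    ... | inj₁ d≤s rewrite b-0 {suc s} (s≤s d≤s) | m≤n⇒m∸n≡0 d≤s = *-zeroʳ (q s)
    ... | inj₂ s<d = begin
      q s * (L₀ * (β (p (suc s)) d (suc s) * (q (suc s) C e)))
        ≡⟨ r₁ (q s) L₀ (β (p (suc s)) d (suc s)) (q (suc s) C e) ⟩
      L₀ * (β (p (suc s)) d (suc s) * (q s * (q (suc s) C e)))
        ≡⟨ cong (λ x → L₀ * (β (p (suc s)) d (suc s) * x)) (C-step s s<k) ⟨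
      L₀ * (β (p (suc s)) d (suc s) * (p s * (q s C e)))
        ≡⟨ r₂ L₀ (β (p (suc s)) d (suc s)) (p s) (q s C e) ⟩
      L₀ * (p s * β (p (suc s)) d (suc s) * (q s C e))
        ≡⟨ cong (λ x → L₀ * (x * (q s C e))) β-step′ ⟩
      L₀ * ((d ∸ s) * β (p s) d s * (q s C e))
        ≡⟨ r₃ L₀ (d ∸ s) (β (p s) d s) (q s C e) ⟩
      (d ∸ s) * (L₀ * (β (p s) d s * (q s C e))) ∎
      where
      open ≡-Reasoning
      e = k ∸ d
      β-step′ : p s * β (p (suc s)) d (suc s) ≡ (d ∸ s) * β (p s) d s
      β-step′ rewrite p-suc s s<k = β-step (p (suc s)) s<d
      r₁ : ∀ q l x y → q * (l * (x * y)) ≡ l * (x * (q * y))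
      r₁ = solve-∀
      r₂ : ∀ l x p y → l * (x * (p * y)) ≡ l * (p * x * y)
      r₂ = solve-∀
      r₃ : ∀ l t x y → l * (t * x * y) ≡ t * (l * (x * y))
      r₃ = solve-∀

    0<k : 0 < k
    0<k = <-trans (s≤s z≤n) (<-trans 2≤d d<k)

    -- The value of `L` is chosen to make this true. It brings `a` and `b` to the same scale, as
    -- required for the form to vanish at levels 0 and 1.
    b₀-a₀ : p 0 * b 0 ≡ q 0 * a 0
    b₀-a₀ = begin
      p 0 * (L₀ * ((p 0 C d) * (q 0 C e)))       ≡⟨ r (p 0) L₀ (p 0 C d) (q 0 C e) ⟩
      L₀ * ((p 0 C d) * (p 0 * (q 0 C e)))       ≡⟨ cong (λ x → L₀ * ((p 0 C d) * x)) (C-step 0 0<k) ⟩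
      L₀ * ((p 0 C d) * (q 0 * (q 1 C e)))       ≡⟨ r′ L₀ (p 0 C d) (q 0) (q 1 C e) ⟩
      q 0 * ((p 0 C d) * (q 1 C e) * L₀)         ≡⟨ cong₂ (λ x y → q 0 * ((x C d) * (y C e) * L₀)) p0 q1 ⟩
      q 0 * (L * L₀)                             ≡⟨ cong (λ x → q 0 * (L * (x C k))) p0 ⟨
      q 0 * (L * (p 0 C k))                      ∎
      where
      open ≡-Reasoning
      e = k ∸ d
      p0 : p 0 ≡ n ∸ k
      p0 = cong (n ∸_) (+-identityʳ k)
      q1 : q 1 ≡ n ∸ suc d
      q1 = cong (n ∸_) (+-comm d 1)
      r : ∀ p l x y → p * (l * (x * y)) ≡ l * (x * (p * y))
      r = solve-∀
      r′ : ∀ l x q y → l * (x * (q * y)) ≡ q * (x * y * l)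
      r′ = solve-∀

    c-a₀ : p 0 * c ≡ (k ∸ d) * a 0
    c-a₀ = begin
      p 0 * (L₀ * (x * ((n ∸ suc d) C (k ∸ suc d))))  ≡⟨ r (p 0) L₀ x ((n ∸ suc d) C (k ∸ suc d)) ⟩
      L₀ * (x * (p 0 * ((n ∸ suc d) C (k ∸ suc d))))  ≡⟨ cong (λ y → L₀ * (x * y)) adjacent ⟩
      L₀ * (x * ((k ∸ d) * ((n ∸ suc d) C (k ∸ d))))  ≡⟨ r′ L₀ x (k ∸ d) ((n ∸ suc d) C (k ∸ d)) ⟩
      (k ∸ d) * (L * L₀)                              ≡⟨ cong (λ y → (k ∸ d) * (L * (y C k))) p0 ⟨
      (k ∸ d) * (L * (p 0 C k))                       ∎
      where
      open ≡-Reasoning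
      x = (n ∸ k) C d
      p0 : p 0 ≡ n ∸ k
      p0 = cong (n ∸_) (+-identityʳ k)
      e≡ : k ∸ d ≡ suc (k ∸ suc d)
      e≡ = ∸-pred k d d<k
      q1 : n ∸ suc d ≡ p 1 + suc (k ∸ suc d)
      q1 = trans (cong (n ∸_) (+-comm 1 d)) (trans (q≡p+e 1 0<k) (cong (p 1 +_) e≡))
      adjacent : p 0 * ((n ∸ suc d) C (k ∸ suc d)) ≡ (k ∸ d) * ((n ∸ suc d) C (k ∸ d))
      adjacent rewrite e≡ | q1 | p-suc 0 0<k = C-adjacent (p 1) (k ∸ suc d)
      r : ∀ p l x y → p * (l * (x * y)) ≡ l * (x * (p * y))
      r = solve-∀
      r′ : ∀ l x q y → l * (x * (q * y)) ≡ q * (x * y * l)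
      r′ = solve-∀

    -- Equivalent to a zero eigenvalue at level 0. Up to the factor a 0 / p 0 it reads n - d = (n -
    -- k) + (k - d).
    b₀≡a₀+c : b 0 ≡ a 0 + c
    b₀≡a₀+c = *-cancelˡ-≡ (b 0) (a 0 + c) (p 0) {{p>0 0 0<k}} (begin
      p 0 * b 0                        ≡⟨ b₀-a₀ ⟩
      q 0 * a 0                        ≡⟨ cong (_* a 0) (q≡p+e 0 z≤n) ⟩
      (p 0 + (k ∸ d)) * a 0            ≡⟨ *-distribʳ-+ (a 0) (p 0) (k ∸ d) ⟩
      p 0 * a 0 + (k ∸ d) * a 0        ≡⟨ cong (p 0 * a 0 +_) c-a₀ ⟨
      p 0 * a 0 + p 0 * c              ≡⟨ *-distribˡ-+ (p 0) (a 0) c ⟨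
      p 0 * (a 0 + c)                  ∎)
      where open ≡-Reasoning

    b₁-a₀ : p 0 * b 1 ≡ d * a 0
    b₁-a₀ = *-cancelˡ-≡ (p 0 * b 1) (d * a 0) (q 0) {{q>0 0 0<k}} (begin
      q 0 * (p 0 * b 1)     ≡⟨ swap (q 0) (p 0) (b 1) ⟩
      p 0 * (q 0 * b 1)     ≡⟨ cong (p 0 *_) (b-step 0 0<k) ⟩
      p 0 * (d * b 0)       ≡⟨ swap (p 0) d (b 0) ⟩
      d * (p 0 * b 0)       ≡⟨ cong (d *_) b₀-a₀ ⟩
      d * (q 0 * a 0)       ≡⟨ swap d (q 0) (a 0) ⟩
      q 0 * (d * a 0)       ∎)
      where
      open ≡-Reasoning
      swap : ∀ a b c → a * (b * c) ≡ b * (a * c)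
      swap = solve-∀

    -- Equivalent to a zero eigenvalue at level 1, where the sign is negative. Up to the factor a 0
    -- / p 0 it reads k = (k - d) + d.
    a₁≡c+b₁ : a 1 ≡ c + b 1
    a₁≡c+b₁ = *-cancelˡ-≡ (a 1) (c + b 1) (p 0) {{p>0 0 0<k}} (begin
      p 0 * a 1                    ≡⟨ a-step 0 0<k ⟩
      k * a 0                      ≡⟨ cong (_* a 0) (m∸n+n≡m (<⇒≤ d<k)) ⟨
      (k ∸ d + d) * a 0            ≡⟨ *-distribʳ-+ (a 0) (k ∸ d) d ⟩
      (k ∸ d) * a 0 + d * a 0      ≡⟨ cong₂ _+_ c-a₀ b₁-a₀ ⟨
      p 0 * c + p 0 * b 1          ≡⟨ *-distribˡ-+ (p 0) c (b 1) ⟨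
      p 0 * (c + b 1)              ∎)
      where open ≡-Reasoning

    -- From one level to the next, `b` gains the factor (d - s) / q s and `a` the factor (k - s) / p
    -- s, which is at least as large. The induction starts at level 1, since at level 0 the
    -- inequality is reversed by `b₀≡a₀+c`.
    b≤a : ∀ s → suc s ≤ k → b (suc s) ≤ a (suc s)
    b≤a zero    _   = ≤-trans (m≤n+m (b 1) c) (≤-reflexive (sym a₁≡c+b₁))
    b≤a (suc s) s<k = *-cancelˡ-≤ (P * Q) {{m*n≢0 P Q {{p>0 (suc s) s<k}} {{q>0 (suc s) s<k}}}} (begin
      P * Q * b (2 + s)             ≡⟨ *-assoc P Q (b (2 + s)) ⟩
      P * (Q * b (2 + s))           ≡⟨ cong (P *_) (b-step (suc s) s<k) ⟩
      P * ((d ∸ suc s) * b (suc s)) ≤⟨ *-mono-≤ (p≤q (suc s)) (*-mono-≤ (∸-monoˡ-≤ (suc s) (<⇒≤ d<k)) (b≤a s (<⇒≤ s<k))) ⟩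
      Q * ((k ∸ suc s) * a (suc s)) ≡⟨ cong (Q *_) (a-step (suc s) s<k) ⟨
      Q * (P * a (2 + s))           ≡⟨ swap Q P (a (2 + s)) ⟩
      P * Q * a (2 + s)             ∎)
      where
      open ≤-Reasoning
      P = p (suc s)
      Q = q (suc s)
      swap : ∀ a b c → a * (b * c) ≡ b * a * c
      swap = solve-∀

    -- The factors that `product-difference` splits off for l = k and l = d.
    A B : ℕ
    A = n ∸ (k + k)
    B = n ∸ (d + d)

    -- Multiplied by n - 3, both sides split off 2 (p 1) (p 2) (q 1) (q 2).  What
    -- remains follows from (d - 2) (n - 2d - 1) ≤ (k - 2) (n - 2k - 1), the only
    -- place where the full strength of n ≥ 2k + 2d - 3 is needed.
    polynomial-bound : d * (B * (p 1 * p 2)) ≤ k * (A * (q 1 * q 2))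
    polynomial-bound with m≤n⇒∃[o]m+o≡n 2≤d | m≤n⇒∃[o]m+o≡n d<k
    -- Now d = 2 + x and k = 3 + x + y, and w below is the slack in n = 2k + 2d - 3 + w. All
    -- truncated differences become polynomials with nonnegative coefficients.
    ... | x , refl | y , refl = go (m≤n⇒∃[o]m+o≡n n≥)
      where
      n≥ : 7 + 4 * x + 2 * y ≤ n
      n≥ = +-cancelˡ-≤ 3 (7 + 4 * x + 2 * y) n (≤-trans (≤-reflexive (r x y)) bound)
        where
        r : ∀ x y → 3 + (7 + 4 * x + 2 * y) ≡ 2 * (3 + x + y) + 2 * (2 + x)
        r = solve-∀
      go : ∃[ w ] (7 + 4 * x + 2 * y + w ≡ n) → d * (B * (p 1 * p 2)) ≤ k * (A * (q 1 * q 2))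
      go (w , eq) = *-cancelˡ-≤ (4 + 4 * x + 2 * y + w) (begin
        m * (d * (B * (p 1 * p 2)))
          ≡⟨ cong₂ (λ b u → m * (d * (b * u))) B≡ (cong₂ _*_ p1≡ p2≡) ⟩
        m * ((2 + x) * ((3 + 2 * x + 2 * y + w) * U))
          ≡⟨ i₁ x y w U ⟩
        (2 * V + x * (2 + 2 * x + 2 * y + w) * (5 + 4 * x + 2 * y + w)) * U
          ≡⟨ i₂ V (x * (2 + 2 * x + 2 * y + w) * (5 + 4 * x + 2 * y + w)) U ⟩
        2 * U * V + x * (2 + 2 * x + 2 * y + w) * (5 + 4 * x + 2 * y + w) * U
          ≤⟨ +-monoʳ-≤ (2 * U * V) (*-mono-≤ (*-monoˡ-≤ (5 + 4 * x + 2 * y + w) product-bound) U≤V) ⟩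
        2 * U * V + (1 + x + y) * (2 * x + w) * (5 + 4 * x + 2 * y + w) * V
          ≡⟨ *-distribʳ-+ V (2 * U) ((1 + x + y) * (2 * x + w) * (5 + 4 * x + 2 * y + w)) ⟨
        (2 * U + (1 + x + y) * (2 * x + w) * (5 + 4 * x + 2 * y + w)) * V
          ≡⟨ i₃ x y w V ⟨
        m * ((3 + x + y) * ((1 + 2 * x + w) * V))
          ≡⟨ cong₂ (λ b u → m * (k * (b * u))) A≡ (cong₂ _*_ q1≡ q2≡) ⟨
        m * (k * (A * (q 1 * q 2))) ∎)
        where
        open ≤-Reasoning
        m U V : ℕ
        m = 4 + 4 * x + 2 * y + w
        U = (3 + 3 * x + y + w) * (2 + 3 * x + y + w)
        V = (4 + 3 * x + 2 * y + w) * (3 + 3 * x + 2 * y + w)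
        B≡ : B ≡ 3 + 2 * x + 2 * y + w
        B≡ = ∸-unique (d + d) (trans (sym eq) (r x y w))
          where
          r : ∀ x y w → 7 + 4 * x + 2 * y + w ≡ (2 + x) + (2 + x) + (3 + 2 * x + 2 * y + w)
          r = solve-∀
        A≡ : A ≡ 1 + 2 * x + w
        A≡ = ∸-unique (k + k) (trans (sym eq) (r x y w))
          where
          r : ∀ x y w → 7 + 4 * x + 2 * y + w ≡ (3 + x + y) + (3 + x + y) + (1 + 2 * x + w)
          r = solve-∀
        p1≡ : p 1 ≡ 3 + 3 * x + y + w
        p1≡ = ∸-unique (k + 1) (trans (sym eq) (r x y w))
          where
          r : ∀ x y w → 7 + 4 * x + 2 * y + w ≡ (3 + x + y) + 1 + (3 + 3 * x + y + w)
          r = solve-∀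
        p2≡ : p 2 ≡ 2 + 3 * x + y + w
        p2≡ = ∸-unique (k + 2) (trans (sym eq) (r x y w))
          where
          r : ∀ x y w → 7 + 4 * x + 2 * y + w ≡ (3 + x + y) + 2 + (2 + 3 * x + y + w)
          r = solve-∀
        q1≡ : q 1 ≡ 4 + 3 * x + 2 * y + w
        q1≡ = ∸-unique (d + 1) (trans (sym eq) (r x y w))
          where
          r : ∀ x y w → 7 + 4 * x + 2 * y + w ≡ (2 + x) + 1 + (4 + 3 * x + 2 * y + w)
          r = solve-∀
        q2≡ : q 2 ≡ 3 + 3 * x + 2 * y + w
        q2≡ = ∸-unique (d + 2) (trans (sym eq) (r x y w))
          where
          r : ∀ x y w → 7 + 4 * x + 2 * y + w ≡ (2 + x) + 2 + (3 + 3 * x + 2 * y + w)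
          r = solve-∀
        U≤V : U ≤ V
        U≤V = *-mono-≤ (step 3) (step 2)
          where
          r : ∀ i x y w → i + 3 * x + y + w + (1 + y) ≡ 1 + i + 3 * x + 2 * y + w
          r = solve-∀
          step : ∀ i → i + 3 * x + y + w ≤ 1 + i + 3 * x + 2 * y + w
          step i = ≤-trans (m≤m+n (i + 3 * x + y + w) (1 + y)) (≤-reflexive (r i x y w))
        product-bound : x * (2 + 2 * x + 2 * y + w) ≤ (1 + x + y) * (2 * x + w)
        product-bound = ≤-trans (m≤m+n (x * (2 + 2 * x + 2 * y + w)) (w * (1 + y))) (≤-reflexive (r x y w))
          where
          r : ∀ x y w → x * (2 + 2 * x + 2 * y + w) + w * (1 + y) ≡ (1 + x + y) * (2 * x + w)
          r = solve-∀
        i₁ : ∀ x y w u → (4 + 4 * x + 2 * y + w) * ((2 + x) * ((3 + 2 * x + 2 * y + w) * u))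
           ≡ (2 * ((4 + 3 * x + 2 * y + w) * (3 + 3 * x + 2 * y + w))
              + x * (2 + 2 * x + 2 * y + w) * (5 + 4 * x + 2 * y + w)) * u
        i₁ = solve-∀
        i₂ : ∀ v z u → (2 * v + z) * u ≡ 2 * u * v + z * u
        i₂ = solve-∀
        i₃ : ∀ x y w v → (4 + 4 * x + 2 * y + w) * ((3 + x + y) * ((1 + 2 * x + w) * v))
           ≡ (2 * ((3 + 3 * x + y + w) * (2 + 3 * x + y + w))
              + (1 + x + y) * (2 * x + w) * (5 + 4 * x + 2 * y + w)) * v
        i₃ = solve-∀

    -- Up to the common factor n - 2s - 1 this says a s - a (2 + s) ≥ b s - b (2 + s).
    descent : ∀ s → suc s < k → b (suc s) * (B * (p (1 + s) * p (2 + s))) ≤ a (suc s) * (A * (q (1 + s) * q (2 + s)))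
    descent zero _ = *-cancelˡ-≤ (p 0) {{p>0 0 0<k}} (begin
      p 0 * (b 1 * (B * (p 1 * p 2)))     ≡⟨ *-assoc (p 0) (b 1) (B * (p 1 * p 2)) ⟨
      p 0 * b 1 * (B * (p 1 * p 2))       ≡⟨ cong (_* (B * (p 1 * p 2))) b₁-a₀ ⟩
      d * a 0 * (B * (p 1 * p 2))         ≡⟨ swap d (a 0) (B * (p 1 * p 2)) ⟩
      a 0 * (d * (B * (p 1 * p 2)))       ≤⟨ *-monoʳ-≤ (a 0) polynomial-bound ⟩
      a 0 * (k * (A * (q 1 * q 2)))       ≡⟨ swap k (a 0) (A * (q 1 * q 2)) ⟨
      k * a 0 * (A * (q 1 * q 2))         ≡⟨ cong (_* (A * (q 1 * q 2))) (a-step 0 0<k) ⟨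
      p 0 * a 1 * (A * (q 1 * q 2))       ≡⟨ *-assoc (p 0) (a 1) (A * (q 1 * q 2)) ⟩
      p 0 * (a 1 * (A * (q 1 * q 2)))     ∎)
      where
      open ≤-Reasoning
      swap : ∀ x y z → x * y * z ≡ y * (x * z)
      swap = solve-∀
    descent (suc s) s+2<k = *-cancelˡ-≤ (P * Q) {{m*n≢0 P Q {{p>0 (suc s) s+1<k}} {{q>0 (suc s) s+1<k}}}} (begin
      P * Q * (b (2 + s) * (B * (p (2 + s) * p (3 + s))))
        ≡⟨ r₁ P Q (b (2 + s)) B (p (2 + s)) (p (3 + s)) ⟩
      Q * b (2 + s) * (B * (P * p (2 + s)) * p (3 + s))
        ≡⟨ cong (_* (B * (P * p (2 + s)) * p (3 + s))) (b-step (suc s) s+1<k) ⟩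
      (d ∸ suc s) * b (1 + s) * (B * (P * p (2 + s)) * p (3 + s))
        ≡⟨ r₂ (d ∸ suc s) (b (1 + s)) (B * (P * p (2 + s))) (p (3 + s)) ⟩
      (d ∸ suc s) * p (3 + s) * (b (1 + s) * (B * (P * p (2 + s))))
        ≤⟨ *-mono-≤ (*-mono-≤ (∸-monoˡ-≤ (suc s) (<⇒≤ d<k)) (p≤q (3 + s))) (descent s s+1<k) ⟩
      (k ∸ suc s) * q (3 + s) * (a (1 + s) * (A * (Q * q (2 + s))))
        ≡⟨ r₂ (k ∸ suc s) (a (1 + s)) (A * (Q * q (2 + s))) (q (3 + s)) ⟨
      (k ∸ suc s) * a (1 + s) * (A * (Q * q (2 + s)) * q (3 + s))
        ≡⟨ cong (_* (A * (Q * q (2 + s)) * q (3 + s))) (a-step (suc s) s+1<k) ⟨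
      P * a (2 + s) * (A * (Q * q (2 + s)) * q (3 + s))
        ≡⟨ r₁ Q P (a (2 + s)) A (q (2 + s)) (q (3 + s)) ⟨
      Q * P * (a (2 + s) * (A * (q (2 + s) * q (3 + s))))
        ≡⟨ cong (_* (a (2 + s) * (A * (q (2 + s) * q (3 + s))))) (*-comm Q P) ⟩
      P * Q * (a (2 + s) * (A * (q (2 + s) * q (3 + s)))) ∎)
      where
      open ≤-Reasoning
      s+1<k : suc s < k
      s+1<k = <⇒≤ s+2<k
      P = p (suc s)
      Q = q (suc s)
      r₁ : ∀ p q b c x y → p * q * (b * (c * (x * y))) ≡ q * b * (c * (p * x) * y)
      r₁ = solve-∀
      r₂ : ∀ t b x y → t * b * (x * y) ≡ t * y * (b * x)
      r₂ = solve-∀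

    -- For l = k it shows that a s - a (2 + s) is `a s` times (n - 2k)(n - 2s - 1) / (p s p (1 +
    -- s)); l = d does the same for `b`. The factor n - 2s - 1 does not depend on l and drops out of
    -- the comparison.
    product-difference : ∀ l s → s < l → l + l ≤ n →
      (n ∸ (l + s)) * (n ∸ (l + suc s)) ≡ (l ∸ s) * (l ∸ suc s) + (n ∸ (l + l)) * (n ∸ suc (s + s))
    product-difference l s s<l 2l≤n with m≤n⇒∃[o]m+o≡n s<l | m≤n⇒∃[o]m+o≡n 2l≤n
    ... | t , refl | v , eq = begin
      (n ∸ (l + s)) * (n ∸ (l + suc s))
        ≡⟨ cong₂ _*_ (∸-unique (l + s) (trans (sym eq) (r₁ s t v))) (∸-unique (l + suc s) (trans (sym eq) (r₂ s t v))) ⟩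
      (1 + t + v) * (t + v)
        ≡⟨ r₅ s t v ⟩
      (1 + t) * t + v * (1 + t + t + v)
        ≡⟨ cong₂ _+_ (cong₂ _*_ (sym l∸s) (sym (m+n∸m≡n s t)))
                     (cong₂ _*_ (sym (∸-unique (l + l) (sym eq))) (sym (∸-unique (suc (s + s)) (trans (sym eq) (r₃ s t v))))) ⟩
      (l ∸ s) * (l ∸ suc s) + (n ∸ (l + l)) * (n ∸ suc (s + s)) ∎
      where
      open ≡-Reasoning
      l∸s : l ∸ s ≡ 1 + t
      l∸s = trans (cong (_∸ s) (sym (+-suc s t))) (m+n∸m≡n s (1 + t))
      r₁ : ∀ s t v → suc (s + t) + suc (s + t) + v ≡ suc (s + t) + s + (1 + t + v)
      r₁ = solve-∀
      r₂ : ∀ s t v → suc (s + t) + suc (s + t) + v ≡ suc (s + t) + suc s + (t + v)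
      r₂ = solve-∀
      r₃ : ∀ s t v → suc (s + t) + suc (s + t) + v ≡ suc (s + s) + (1 + t + t + v)
      r₃ = solve-∀
      r₅ : ∀ s t v → (1 + t + v) * (t + v) ≡ (1 + t) * t + v * (1 + t + t + v)
      r₅ = solve-∀

    a-2step : ∀ s → suc s < k → p s * p (suc s) * a (2 + s) ≡ (k ∸ s) * (k ∸ suc s) * a s
    a-2step s s+1<k = begin
      p s * p (suc s) * a (2 + s)        ≡⟨ *-assoc (p s) (p (suc s)) (a (2 + s)) ⟩
      p s * (p (suc s) * a (2 + s))      ≡⟨ cong (p s *_) (a-step (suc s) s+1<k) ⟩
      p s * ((k ∸ suc s) * a (suc s))    ≡⟨ swap (p s) (k ∸ suc s) (a (suc s)) ⟩
      (k ∸ suc s) * (p s * a (suc s))    ≡⟨ cong ((k ∸ suc s) *_) (a-step s (<⇒≤ s+1<k)) ⟩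
      (k ∸ suc s) * ((k ∸ s) * a s)      ≡⟨ r (k ∸ suc s) (k ∸ s) (a s) ⟩
      (k ∸ s) * (k ∸ suc s) * a s        ∎
      where
      open ≡-Reasoning
      swap : ∀ x y z → x * (y * z) ≡ y * (x * z)
      swap = solve-∀
      r : ∀ x y z → x * (y * z) ≡ y * x * z
      r = solve-∀

    b-2step : ∀ s → suc s < k → q s * q (suc s) * b (2 + s) ≡ (d ∸ s) * (d ∸ suc s) * b s
    b-2step s s+1<k = begin
      q s * q (suc s) * b (2 + s)        ≡⟨ *-assoc (q s) (q (suc s)) (b (2 + s)) ⟩
      q s * (q (suc s) * b (2 + s))      ≡⟨ cong (q s *_) (b-step (suc s) s+1<k) ⟩
      q s * ((d ∸ suc s) * b (suc s))    ≡⟨ swap (q s) (d ∸ suc s) (b (suc s)) ⟩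
      (d ∸ suc s) * (q s * b (suc s))    ≡⟨ cong ((d ∸ suc s) *_) (b-step s (<⇒≤ s+1<k)) ⟩
      (d ∸ suc s) * ((d ∸ s) * b s)      ≡⟨ r (d ∸ suc s) (d ∸ s) (b s) ⟩
      (d ∸ s) * (d ∸ suc s) * b s        ∎
      where
      open ≡-Reasoning
      swap : ∀ x y z → x * (y * z) ≡ y * (x * z)
      swap = solve-∀
      r : ∀ x y z → x * (y * z) ≡ y * x * z
      r = solve-∀

    2d≤n : d + d ≤ n
    2d≤n = ≤-trans (+-mono-≤ (<⇒≤ d<k) (<⇒≤ d<k)) (<⇒≤ 2k<n)

    -- The factor `b s` extends `product-difference` beyond s < d: at s = d the product (d - s)(d -
    -- s - 1) is zero and the rest agrees, and for s > d `b s` is zero.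
    b-product : ∀ s → b s * (q s * q (suc s)) ≡ b s * ((d ∸ s) * (d ∸ suc s) + B * (n ∸ suc (s + s)))
    b-product s with <-cmp s d
    ... | tri< s<d _ _ = cong (b s *_) (product-difference d s s<d 2d≤n)
    ... | tri≈ _ refl _ rewrite n∸n≡0 s | +-suc s s = refl
    ... | tri> _ _ d<s rewrite b-0 d<s = refl

    -- Additive form of a t - a (2 + t) ≥ b t - b (2 + t) for t = 1 + s. After multiplication by the
    -- denominators `PP * QQ` the difference of the two sides is `N` times the difference in
    -- `descent`.
    two-step : ∀ s → 2 + suc s ≤ k → a (2 + suc s) + b (suc s) ≤ a (suc s) + b (2 + suc s)
    two-step s s+2<k = *-cancelˡ-≤ (PP * QQ) {{m*n≢0 PP QQ {{PP≢0}} {{QQ≢0}}}} (begin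
      PP * QQ * (a (2 + t) + b t)
        ≡⟨ r₁ PP QQ (a (2 + t)) (b t) ⟩
      QQ * (PP * a (2 + t)) + PP * (b t * QQ)
        ≡⟨ cong₂ (λ x y → QQ * x + PP * y) (a-2step t t+1<k) (b-product t) ⟩
      QQ * (KK * a t) + PP * (b t * (TT + B * N))
        ≡⟨ r₂ QQ (KK * a t) PP (b t) TT B N ⟩
      QQ * (KK * a t) + PP * (TT * b t) + N * (b t * (B * PP))
        ≤⟨ +-monoʳ-≤ (QQ * (KK * a t) + PP * (TT * b t)) (*-monoʳ-≤ N (descent s (<⇒≤ t+1<k))) ⟩
      QQ * (KK * a t) + PP * (TT * b t) + N * (a t * (A * QQ))
        ≡⟨ r₃ QQ KK (a t) PP (TT * b t) N A ⟩
      QQ * ((KK + A * N) * a t) + PP * (TT * b t)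
        ≡⟨ cong₂ (λ x y → QQ * (x * a t) + PP * y) (product-difference k t (<⇒≤ t+1<k) (<⇒≤ 2k<n)) (b-2step t t+1<k) ⟨
      QQ * (PP * a t) + PP * (QQ * b (2 + t))
        ≡⟨ r₄ QQ PP (a t) (b (2 + t)) ⟩
      PP * QQ * (a t + b (2 + t)) ∎)
      where
      open ≤-Reasoning
      t PP QQ KK TT N : ℕ
      t  = suc s
      PP = p t * p (suc t)
      QQ = q t * q (suc t)
      KK = (k ∸ t) * (k ∸ suc t)
      TT = (d ∸ t) * (d ∸ suc t)
      N  = n ∸ suc (t + t)
      t+1<k : suc t < k
      t+1<k = s+2<k
      PP≢0 : NonZero PP
      PP≢0 = m*n≢0 (p t) (p (suc t)) {{p>0 t (<⇒≤ t+1<k)}} {{p>0 (suc t) t+1<k}}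
      QQ≢0 : NonZero QQ
      QQ≢0 = m*n≢0 (q t) (q (suc t)) {{q>0 t (<⇒≤ t+1<k)}} {{q>0 (suc t) t+1<k}}
      r₁ : ∀ p q x y → p * q * (x + y) ≡ q * (p * x) + p * (y * q)
      r₁ = solve-∀
      r₂ : ∀ q z p b t c m → q * z + p * (b * (t + c * m)) ≡ q * z + p * (t * b) + m * (b * (c * p))
      r₂ = solve-∀
      r₃ : ∀ q k x p z m c → q * (k * x) + p * z + m * (x * (c * q)) ≡ q * ((k + c * m) * x) + p * z
      r₃ = solve-∀
      r₄ : ∀ q p x y → q * (p * x) + p * (q * y) ≡ p * q * (x + y)
      r₄ = solve-∀

    d+k≤n : d + k ≤ n
    d+k≤n = ≤-trans (+-monoˡ-≤ k (<⇒≤ d<k)) (<⇒≤ 2k<n)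

    -- Lets the level-s terms of the form on d-sets and of those on k-sets share the factor
    -- `β (n ∸ (s + s)) k s`. With d = s + i, k = d + e and n = d + k + m it is `C-exchange′`; for s
    -- > d both sides vanish.
    exchange : ∀ s → β (n ∸ (s + s)) d s * ((n ∸ (d + s)) C (k ∸ d)) * β (n ∸ (d + s)) k s
      ≡ β (n ∸ (s + s)) k s * (β (n ∸ (k + s)) d s * ((n ∸ (d + s)) C (k ∸ d)))
    exchange s with ≤-<-connex s d
    ... | inj₂ d<s rewrite β-0 (n ∸ (s + s)) d<s | β-0 (n ∸ (k + s)) d<s = sym (*-zeroʳ (β (n ∸ (s + s)) k s))
    ... | inj₁ s≤d with m≤n⇒∃[o]m+o≡n s≤d | m≤n⇒∃[o]m+o≡n (<⇒≤ d<k) | m≤n⇒∃[o]m+o≡n d+k≤n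
    ... | i , refl | e , refl | m , eq
      rewrite β-C (n ∸ (s + s)) s≤d | β-C (n ∸ (k + s)) s≤d
            | β-C (n ∸ (s + s)) (≤-trans s≤d (<⇒≤ d<k)) | β-C (n ∸ (d + s)) (≤-trans s≤d (<⇒≤ d<k))
            | m+n∸m≡n s i | m+n∸m≡n (s + i) e
            | trans (cong (_∸ s) (+-assoc s i e)) (m+n∸m≡n s (i + e))
      = C-exchange′ i e m
          (∸-unique (s + s) (trans (sym eq) (r₁ s i e m)))
          (∸-unique (d + s) (trans (sym eq) (r₂ s i e m)))
          (∸-unique (k + s) (trans (sym eq) (r₃ s i e m)))
      where
      r₁ : ∀ s i e m → s + i + (s + i + e) + m ≡ s + s + (m + i + (i + e))
      r₁ = solve-∀
      r₂ : ∀ s i e m → s + i + (s + i + e) + m ≡ s + i + s + (m + (i + e))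
      r₂ = solve-∀
      r₃ : ∀ s i e m → s + i + (s + i + e) + m ≡ s + i + e + s + (m + i)
      r₃ = solve-∀

    b≤c+a : ∀ s → sgn s ≡ 1ℤ → s ≤ k → b s ≤ c + a s
    b≤c+a zero    _ _   = ≤-reflexive (trans b₀≡a₀+c (+-comm (a 0) c))
    b≤c+a (suc s) _ s<k = ≤-trans (b≤a s s<k) (m≤n+m (a (suc s)) c)

    -- Induction in steps of two from the equality at level 1, because by `two-step` the difference
    -- a s - b s does not grow from s to s + 2.
    a≤c+b : ∀ s → sgn s ≡ -1ℤ → s ≤ k → a s ≤ c + b s
    a≤c+b (suc zero)          _  _   = ≤-reflexive a₁≡c+b₁
    a≤c+b (suc (suc (suc s))) eq s≤k = +-cancelʳ-≤ (b (suc s)) (a (3 + s)) (c + b (3 + s)) (begin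
      a (3 + s) + b (suc s)          ≤⟨ two-step s s≤k ⟩
      a (suc s) + b (3 + s)
        ≤⟨ +-monoˡ-≤ (b (3 + s)) (a≤c+b (suc s) (trans (sym (ℤ.neg-involutive (sgn (suc s)))) eq) (m+n≤o⇒n≤o 2 s≤k)) ⟩
      c + b (suc s) + b (3 + s)      ≡⟨ +-assoc c (b (suc s)) (b (3 + s)) ⟩
      c + (b (suc s) + b (3 + s))    ≡⟨ cong (c +_) (+-comm (b (suc s)) (b (3 + s))) ⟩
      c + (b (3 + s) + b (suc s))    ≡⟨ +-assoc c (b (3 + s)) (b (suc s)) ⟨
      c + b (3 + s) + b (suc s)      ∎)
      where open ≤-Reasoning

    eigenvalue : ℕ → ℤ
    eigenvalue s = ℤ.+ c ℤ.+ sgn s ℤ.* (ℤ.+ a s ℤ.- ℤ.+ b s)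

    eigenvalue≥0 : ∀ s → s ≤ k → 0ℤ ℤ.≤ eigenvalue s
    eigenvalue≥0 s s≤k with sgn-cases s
    ... | inj₁ even rewrite even = subst (0ℤ ℤ.≤_) (r (ℤ.+ c) (ℤ.+ a s) (ℤ.+ b s)) (ℤ.i≤j⇒0≤j-i (ℤ.+≤+ (b≤c+a s even s≤k)))
      where
      r : ∀ c a b → (c ℤ.+ a) ℤ.- b ≡ c ℤ.+ 1ℤ ℤ.* (a ℤ.- b)
      r = ℤ-Solver.solve-∀
    ... | inj₂ odd rewrite odd = subst (0ℤ ℤ.≤_) (r (ℤ.+ c) (ℤ.+ a s) (ℤ.+ b s)) (ℤ.i≤j⇒0≤j-i (ℤ.+≤+ (a≤c+b s odd s≤k)))
      where
      r : ∀ c a b → (c ℤ.+ b) ℤ.- a ≡ c ℤ.+ -1ℤ ℤ.* (a ℤ.- b)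
      r = ℤ-Solver.solve-∀

-- Linear operators on functions on the Boolean cube.

module _ where

  open import Data.Integer.Base using (+_; -[1+_]; -_; _+_; _-_; _*_; _≤_; +≤+; nonNegative)
  open import Data.Integer.Tactic.RingSolver using (solve-∀)
  open import Data.Nat.Base using (_∸_)
  open import Data.Nat.Combinatorics using (_C_)
  open import Data.Nat.Properties using (_!≢0)

  Cube : ℕ → Set
  Cube n = Subset n → ℤ

  lo hi : ∀ {n} → Cube (suc n) → Cube n
  lo f S = f (outside ∷ S)
  hi f S = f (inside ∷ S)

  -- A Boolean 2×2 matrix M; T M is its n-fold tensor power acting on Cube n.
  Matrix : Set
  Matrix = Bool → Bool → Bool

  _ᵗ : Matrix → Matrix
  (M ᵗ) b c = M c b

  select : Bool → Bool → ℤ → ℤ → ℤ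
  select false false x y = 0ℤ
  select false true  x y = y
  select true  false x y = x
  select true  true  x y = x + y

  T : Matrix → ∀ {n} → Cube n → Cube n
  T M {zero}  f []      = f []
  T M {suc n} f (b ∷ B) = select (M b false) (M b true) (T M (lo f) B) (T M (hi f) B)

  ∑ : ∀ {n} → Cube n → ℤ
  ∑ {zero}  f = f []
  ∑ {suc n} f = ∑ (lo f) + ∑ (hi f)

  -- `D f S` is the sum of f (S ∪ {x}) over all x outside S.
  D : ∀ {n} → Cube n → Cube n
  D {zero}  f []            = 0ℤ
  D {suc n} f (outside ∷ S) = D (lo f) S + hi f S
  D {suc n} f (inside ∷ S)  = D (hi f) S

  leq disj : Matrix
  leq false _     = true
  leq true  false = false
  leq true  true  = true
  disj true true  = false
  disj true false = true
  disj false _    = true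

  -- X f B sums f over the subsets of B, Y f B over its supersets and Z f B over
  -- the sets disjoint from B.
  X Y Z : ∀ {n} → Cube n → Cube n
  X = T (leq ᵗ)
  Y = T leq
  Z = T disj

  infixr 8 _◃_
  _◃_ : (ℕ → ℤ) → ∀ {n} → Cube n → Cube n
  (φ ◃ f) S = φ ∣ S ∣ * f S

  select-+ : ∀ b c x y z w → select b c (x + y) (z + w) ≡ select b c x z + select b c y w
  select-+ false false x y z w = refl
  select-+ false true  x y z w = refl
  select-+ true  false x y z w = refl
  select-+ true  true  = lemma
    where
    lemma : ∀ x y z w → (x + y) + (z + w) ≡ (x + z) + (y + w)
    lemma = solve-∀

  select-* : ∀ b c a x y → select b c (a * x) (a * y) ≡ a * select b c x y
  select-* false false a x y = sym (ℤ.*-zeroʳ a)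
  select-* false true  a x y = refl
  select-* true  false a x y = refl
  select-* true  true  a x y = sym (ℤ.*-distribˡ-+ a x y)

  T-cong : ∀ M {n} {f g : Cube n} → (∀ S → f S ≡ g S) → ∀ B → T M f B ≡ T M g B
  T-cong M {zero}  f≗g []      = f≗g []
  T-cong M {suc n} f≗g (b ∷ B) =
    cong₂ (select (M b false) (M b true))
      (T-cong M (λ S → f≗g (false ∷ S)) B) (T-cong M (λ S → f≗g (true ∷ S)) B)

  T-+ : ∀ M {n} (f g : Cube n) B → T M (λ S → f S + g S) B ≡ T M f B + T M g B
  T-+ M {zero}  f g []      = refl
  T-+ M {suc n} f g (b ∷ B) = trans
    (cong₂ (select (M b false) (M b true)) (T-+ M (lo f) (lo g) B) (T-+ M (hi f) (hi g) B))
    (select-+ (M b false) (M b true) _ _ _ _)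

  T-* : ∀ M {n} a (f : Cube n) B → T M (λ S → a * f S) B ≡ a * T M f B
  T-* M {zero}  a f []      = refl
  T-* M {suc n} a f (b ∷ B) = trans
    (cong₂ (select (M b false) (M b true)) (T-* M a (lo f) B) (T-* M a (hi f) B))
    (select-* (M b false) (M b true) a _ _)

  ∑-cong : ∀ {n} {f g : Cube n} → (∀ S → f S ≡ g S) → ∑ f ≡ ∑ g
  ∑-cong {zero}  f≗g = f≗g []
  ∑-cong {suc n} f≗g = cong₂ _+_ (∑-cong (λ S → f≗g (_ ∷ S))) (∑-cong (λ S → f≗g (_ ∷ S)))

  interchange : ∀ x y z w → (x + y) + (z + w) ≡ (x + z) + (y + w)
  interchange = solve-∀

  ∑-+ : ∀ {n} (f g : Cube n) → ∑ (λ S → f S + g S) ≡ ∑ f + ∑ g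
  ∑-+ {zero}  f g = refl
  ∑-+ {suc n} f g =
    trans (cong₂ _+_ (∑-+ (lo f) (lo g)) (∑-+ (hi f) (hi g))) (interchange (∑ (lo f)) _ _ _)

  ∑-* : ∀ {n} a (f : Cube n) → ∑ (λ S → a * f S) ≡ a * ∑ f
  ∑-* {zero}  a f = refl
  ∑-* {suc n} a f =
    trans (cong₂ _+_ (∑-* a (lo f)) (∑-* a (hi f))) (sym (ℤ.*-distribˡ-+ a (∑ (lo f)) (∑ (hi f))))

  ∑-0 : ∀ n → ∑ {n} (λ _ → 0ℤ) ≡ 0ℤ
  ∑-0 zero    = refl
  ∑-0 (suc n) = cong₂ _+_ (∑-0 n) (∑-0 n)

  ∑-select : ∀ {n} b c (f g : Cube n) → ∑ (λ S → select b c (f S) (g S)) ≡ select b c (∑ f) (∑ g)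
  ∑-select {n} false false f g = ∑-0 n
  ∑-select false true  f g = refl
  ∑-select true  false f g = refl
  ∑-select true  true  f g = ∑-+ f g

  gate : Bool → ℤ → ℤ
  gate false x = 0ℤ
  gate true  x = x

  select-gate : ∀ b c x y → select b c x y ≡ gate b x + gate c y
  select-gate false false x y = refl
  select-gate false true  x y = sym (ℤ.+-identityˡ y)
  select-gate true  false x y = sym (ℤ.+-identityʳ x)
  select-gate true  true  x y = refl

  -- Sums a 2×2 array of gated entries by columns instead of rows.
  select-interchange : ∀ p q r s x y z w →
    select p q x y + select r s z w ≡ select p r x z + select q s y w
  select-interchange p q r s x y z w = begin
    select p q x y + select r s z w                 ≡⟨ cong₂ _+_ (select-gate p q x y) (select-gate r s z w) ⟩
    (gate p x + gate q y) + (gate r z + gate s w)   ≡⟨ interchange (gate p x) _ _ _ ⟩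
    (gate p x + gate r z) + (gate q y + gate s w)   ≡⟨ cong₂ _+_ (select-gate p r x z) (select-gate q s y w) ⟨
    select p r x z + select q s y w                 ∎
    where open ≡-Reasoning

  -- Exchange of summation: both sides add up w B A over the pairs (B, A) related by `M` in every
  -- coordinate. For `leq` it says that `X` and `Y` are adjoint.
  ∑-transpose : ∀ M {n} (w : Subset n → Subset n → ℤ) →
    ∑ (λ B → T M (w B) B) ≡ ∑ (λ A → T (M ᵗ) (λ B → w B A) A)
  ∑-transpose M {zero}  w = refl
  ∑-transpose M {suc n} w = begin
    ∑ (λ B → select (M false false) (M false true) (t false false B) (t false true B))
    + ∑ (λ B → select (M true false) (M true true) (t true false B) (t true true B))
      ≡⟨ cong₂ _+_ (∑-select (M false false) (M false true) (t false false) (t false true))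
                   (∑-select (M true false) (M true true) (t true false) (t true true)) ⟩
    select (M false false) (M false true) (∑ (t false false)) (∑ (t false true))
    + select (M true false) (M true true) (∑ (t true false)) (∑ (t true true))
      ≡⟨ cong₂ _+_ (cong₂ (select (M false false) (M false true)) (ih false false) (ih false true))
                   (cong₂ (select (M true false) (M true true)) (ih true false) (ih true true)) ⟩
    select (M false false) (M false true) (∑ (u false false)) (∑ (u false true))
    + select (M true false) (M true true) (∑ (u true false)) (∑ (u true true))
      ≡⟨ select-interchange (M false false) (M false true) (M true false) (M true true) _ _ _ _ ⟩
    select (M false false) (M true false) (∑ (u false false)) (∑ (u true false))
    + select (M false true) (M true true) (∑ (u false true)) (∑ (u true true))
      ≡⟨ cong₂ _+_ (∑-select (M false false) (M true false) (u false false) (u true false))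
                   (∑-select (M false true) (M true true) (u false true) (u true true)) ⟨
    ∑ (λ A → select (M false false) (M true false) (u false false A) (u true false A))
    + ∑ (λ A → select (M false true) (M true true) (u false true A) (u true true A)) ∎
    where
    open ≡-Reasoning
    t u : Bool → Bool → Cube n
    t b c B = T M (λ A → w (b ∷ B) (c ∷ A)) B
    u b c A = T (M ᵗ) (λ B → w (b ∷ B) (c ∷ A)) A
    ih : ∀ b c → ∑ (t b c) ≡ ∑ (u b c)
    ih b c = ∑-transpose M (λ B A → w (b ∷ B) (c ∷ A))

  D-cong : ∀ {n} {f g : Cube n} B → (∀ S → ∣ S ∣ ≡ suc ∣ B ∣ → f S ≡ g S) → D f B ≡ D g B
  D-cong []            f≗g = refl
  D-cong (outside ∷ B) f≗g =
    cong₂ _+_ (D-cong B (λ S → f≗g (outside ∷ S))) (f≗g (inside ∷ B) refl)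
  D-cong (inside ∷ B)  f≗g = D-cong B (λ S eq → f≗g (inside ∷ S) (cong suc eq))

  D-+ : ∀ {n} (f g : Cube n) B → D (λ S → f S + g S) B ≡ D f B + D g B
  D-+ f g []            = refl
  D-+ f g (outside ∷ B) =
    trans (cong (_+ (hi f B + hi g B)) (D-+ (lo f) (lo g) B)) (interchange (D (lo f) B) _ _ _)
  D-+ f g (inside ∷ B)  = D-+ (hi f) (hi g) B

  D-* : ∀ {n} a (f : Cube n) B → D (λ S → a * f S) B ≡ a * D f B
  D-* a f []            = sym (ℤ.*-zeroʳ a)
  D-* a f (outside ∷ B) =
    trans (cong (_+ a * hi f B) (D-* a (lo f) B)) (sym (ℤ.*-distribˡ-+ a (D (lo f) B) (hi f B)))
  D-* a f (inside ∷ B)  = D-* a (hi f) B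

  X-cong-≤ : ∀ {n} {f g : Cube n} B → (∀ S → ∣ S ∣ ℕ.≤ ∣ B ∣ → f S ≡ g S) → X f B ≡ X g B
  X-cong-≤ []            f≗g = f≗g [] z≤n
  X-cong-≤ (outside ∷ B) f≗g = X-cong-≤ B (λ S → f≗g (outside ∷ S))
  X-cong-≤ (inside ∷ B)  f≗g = cong₂ _+_
    (X-cong-≤ B (λ S le → f≗g (outside ∷ S) (ℕ.m≤n⇒m≤1+n le)))
    (X-cong-≤ B (λ S le → f≗g (inside ∷ S) (s≤s le)))

  Y-cong-≥ : ∀ {n} {f g : Cube n} A → (∀ S → ∣ A ∣ ℕ.≤ ∣ S ∣ → f S ≡ g S) → Y f A ≡ Y g A
  Y-cong-≥ []            f≗g = f≗g [] z≤n
  Y-cong-≥ (outside ∷ A) f≗g = cong₂ _+_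
    (Y-cong-≥ A (λ S → f≗g (outside ∷ S)))
    (Y-cong-≥ A (λ S le → f≗g (inside ∷ S) (ℕ.m≤n⇒m≤1+n le)))
  Y-cong-≥ (inside ∷ A)  f≗g = Y-cong-≥ A (λ S le → f≗g (inside ∷ S) (s≤s le))

  Z-cong-≤ : ∀ {n} {f g : Cube n} B → (∀ S → ∣ B ∣ ℕ.+ ∣ S ∣ ℕ.≤ n → f S ≡ g S) → Z f B ≡ Z g B
  Z-cong-≤ []            f≗g = f≗g [] z≤n
  Z-cong-≤ (outside ∷ B) f≗g = cong₂ _+_
    (Z-cong-≤ B (λ S le → f≗g (outside ∷ S) (ℕ.m≤n⇒m≤1+n le)))
    (Z-cong-≤ B (λ S le → f≗g (inside ∷ S) (ℕ.≤-trans (ℕ.≤-reflexive (ℕ.+-suc ∣ B ∣ ∣ S ∣)) (s≤s le))))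
  Z-cong-≤ (inside ∷ B)  f≗g = Z-cong-≤ B (λ S le → f≗g (outside ∷ S) (s≤s le))

  -- Commutation relations; `E` multiplies by the cardinality.

  E : ∀ {n} → Cube n → Cube n
  E f = +_ ◃ f

  T-hi-E : ∀ M {n} (f : Cube (suc n)) B → T M (hi (E f)) B ≡ T M (hi f) B + T M (E (hi f)) B
  T-hi-E M f B = trans (T-cong M (λ S → lemma (+ ∣ S ∣) (hi f S)) B) (T-+ M (hi f) (E (hi f)) B)
    where
    lemma : ∀ a x → (1ℤ + a) * x ≡ x + a * x
    lemma = solve-∀

  -- Consider the subsets of B ∪ {x} for x outside B. Those avoiding x contribute (n - |B|) X f B.
  -- Those containing x contribute the terms of X (D f) B whose new element lies outside B; the
  -- terms with new element inside B add up to X (E f) B. All negative terms are moved across.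
  D-X : ∀ {n} (f : Cube n) B →
    D (X f) B + X (E f) B + + ∣ B ∣ * X f B ≡ X (D f) B + + n * X f B
  D-X f [] = lemma (f [])
    where
    lemma : ∀ a → 0ℤ + 0ℤ * a + 0ℤ * a ≡ 0ℤ + 0ℤ * a
    lemma = solve-∀
  D-X {suc n} f (outside ∷ B)
    rewrite T-+ (leq ᵗ) (D (lo f)) (hi f) B
    = lemma (D (X (lo f)) B) (X (E (lo f)) B) (X (D (lo f)) B) (X (lo f) B) (X (hi f) B) (+ ∣ B ∣) (+ n) (D-X (lo f) B)
    where
    lemma : ∀ p q r x y b m → p + q + b * x ≡ r + m * x →
      p + (x + y) + q + b * x ≡ (r + y) + (1ℤ + m) * x
    lemma p q r x y b m eq = trans (e1 p q x y b) (trans (cong (_+ (x + y)) eq) (e2 r x y m))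
      where
      e1 : ∀ p q x y b → p + (x + y) + q + b * x ≡ (p + q + b * x) + (x + y)
      e1 = solve-∀
      e2 : ∀ r x y m → (r + m * x) + (x + y) ≡ (r + y) + (1ℤ + m) * x
      e2 = solve-∀
  D-X {suc n} f (inside ∷ B)
    rewrite T-+ (leq ᵗ) (D (lo f)) (hi f) B | D-+ (X (lo f)) (X (hi f)) B | T-hi-E (leq ᵗ) f B
    = lemma (D (X (lo f)) B) (D (X (hi f)) B) (X (E (lo f)) B) (X (E (hi f)) B)
        (X (lo f) B) (X (hi f) B) (X (D (lo f)) B) (X (D (hi f)) B) (+ ∣ B ∣) (+ n)
        (D-X (lo f) B) (D-X (hi f) B)
    where
    lemma : ∀ p p' q q' x y r r' b m → p + q + b * x ≡ r + m * x → p' + q' + b * y ≡ r' + m * y →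
      (p + p') + (q + (y + q')) + (1ℤ + b) * (x + y) ≡ ((r + y) + r') + (1ℤ + m) * (x + y)
    lemma p p' q q' x y r r' b m eq eq' =
      trans (e1 p p' q q' x y b) (trans (cong₂ (λ u v → u + v + (x + y + y)) eq eq') (e2 r r' x y m))
      where
      e1 : ∀ p p' q q' x y b → (p + p') + (q + (y + q')) + (1ℤ + b) * (x + y)
         ≡ (p + q + b * x) + (p' + q' + b * y) + (x + y + y)
      e1 = solve-∀
      e2 : ∀ r r' x y m → (r + m * x) + (r' + m * y) + (x + y + y) ≡ ((r + y) + r') + (1ℤ + m) * (x + y)
      e2 = solve-∀

  private
    lemma-out : ∀ p p' x y s s' b → p + b * x ≡ s → p' + b * y ≡ s' →
      (p + y + p') + b * (x + y) ≡ s + (y + s')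
    lemma-out p p' x y s s' b refl refl = e p p' x y b
      where
      e : ∀ p p' x y b → (p + y + p') + b * (x + y) ≡ (p + b * x) + (y + (p' + b * y))
      e = solve-∀

    lemma-in : ∀ p y s b → p + b * y ≡ s → p + (1ℤ + b) * y ≡ y + s
    lemma-in p y s b refl = e p y b
      where
      e : ∀ p y b → p + (1ℤ + b) * y ≡ y + (p + b * y)
      e = solve-∀

  -- A superset S of A arises from a smaller superset of A by adding one element in |S| - |A| ways.
  Y-D : ∀ {n} (f : Cube n) A → Y (D f) A + + ∣ A ∣ * Y f A ≡ Y (E f) A
  Y-D f [] = refl
  Y-D f (outside ∷ A)
    rewrite T-+ leq (D (lo f)) (hi f) A | T-hi-E leq f A
    = lemma-out (Y (D (lo f)) A) (Y (D (hi f)) A) (Y (lo f) A) (Y (hi f) A)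
        (Y (E (lo f)) A) (Y (E (hi f)) A) (+ ∣ A ∣) (Y-D (lo f) A) (Y-D (hi f) A)
  Y-D f (inside ∷ A) rewrite T-hi-E leq f A
    = lemma-in (Y (D (hi f)) A) (Y (hi f) A) (Y (E (hi f)) A) (+ ∣ A ∣) (Y-D (hi f) A)

  -- A superset S of A contains A ∪ {x} for |S| - |A| choices of x outside A.
  D-Y : ∀ {n} (f : Cube n) A → D (Y f) A + + ∣ A ∣ * Y f A ≡ Y (E f) A
  D-Y f [] = refl
  D-Y f (outside ∷ A)
    rewrite D-+ (Y (lo f)) (Y (hi f)) A | T-hi-E leq f A
    = lemma (D (Y (lo f)) A) (D (Y (hi f)) A) (Y (lo f) A) (Y (hi f) A)
        (Y (E (lo f)) A) (Y (E (hi f)) A) (+ ∣ A ∣) (D-Y (lo f) A) (D-Y (hi f) A)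
    where
    lemma : ∀ p p' x y s s' b → p + b * x ≡ s → p' + b * y ≡ s' →
      (p + p' + y) + b * (x + y) ≡ s + (y + s')
    lemma p p' x y s s' b refl refl = e p p' x y b
      where
      e : ∀ p p' x y b → (p + p' + y) + b * (x + y) ≡ (p + b * x) + (y + (p' + b * y))
      e = solve-∀
  D-Y f (inside ∷ A) rewrite T-hi-E leq f A
    = lemma-in (D (Y (hi f)) A) (Y (hi f) A) (Y (E (hi f)) A) (+ ∣ A ∣) (D-Y (hi f) A)

  -- Inclusion–exclusion over the subsets of A ∩ B.
  Z-X-Y : ∀ {n} (f : Cube n) B → Z f B ≡ X (sgn ◃ Y f) B
  Z-X-Y f [] = sym (ℤ.*-identityˡ (f []))
  Z-X-Y f (outside ∷ B) = begin
    Z (lo f) B + Z (hi f) B                                  ≡⟨ cong₂ _+_ (Z-X-Y (lo f) B) (Z-X-Y (hi f) B) ⟩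
    X (sgn ◃ Y (lo f)) B + X (sgn ◃ Y (hi f)) B              ≡⟨ T-+ (leq ᵗ) (sgn ◃ Y (lo f)) (sgn ◃ Y (hi f)) B ⟨
    X (λ S → (sgn ◃ Y (lo f)) S + (sgn ◃ Y (hi f)) S) B
      ≡⟨ T-cong (leq ᵗ) (λ S → sym (ℤ.*-distribˡ-+ (sgn ∣ S ∣) (Y (lo f) S) (Y (hi f) S))) B ⟩
    X (sgn ◃ (λ S → Y (lo f) S + Y (hi f) S)) B              ∎
    where open ≡-Reasoning
  Z-X-Y f (inside ∷ B) = begin
    Z (lo f) B ≡⟨ Z-X-Y (lo f) B ⟩
    X (sgn ◃ Y (lo f)) B
      ≡⟨ T-cong (leq ᵗ) (λ S → lemma (sgn ∣ S ∣) (Y (lo f) S) (Y (hi f) S)) B ⟩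
    X (λ S → (sgn ◃ (λ S → Y (lo f) S + Y (hi f) S)) S + (- sgn ∣ S ∣) * Y (hi f) S) B
      ≡⟨ T-+ (leq ᵗ) (sgn ◃ (λ S → Y (lo f) S + Y (hi f) S)) (λ S → (- sgn ∣ S ∣) * Y (hi f) S) B ⟩
    X (sgn ◃ (λ S → Y (lo f) S + Y (hi f) S)) B + X (λ S → (- sgn ∣ S ∣) * Y (hi f) S) B ∎
    where
    open ≡-Reasoning
    lemma : ∀ a x y → a * x ≡ a * (x + y) + - a * y
    lemma = solve-∀

  -- Restriction to a level by `ind k ◃ f`, and harmonic functions.

  ind : ℕ → ℕ → ℤ
  ind zero    zero    = 1ℤ
  ind (suc a) (suc b) = ind a b
  ind _       _       = 0ℤ

  ind-refl : ∀ a → ind a a ≡ 1ℤ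
  ind-refl zero    = refl
  ind-refl (suc a) = ind-refl a

  ind-< : ∀ {a b} → a ℕ.< b → ind a b ≡ 0ℤ
  ind-< {zero}  (s≤s _)   = refl
  ind-< {suc a} (s≤s a<b) = ind-< a<b

  ind-> : ∀ {a b} → b ℕ.< a → ind a b ≡ 0ℤ
  ind-> {b = zero}  (s≤s _)   = refl
  ind-> {b = suc b} (s≤s b<a) = ind-> b<a

  ind-≢ : ∀ {a b} → a ≢ b → ind a b ≡ 0ℤ
  ind-≢ {zero}  {zero}  a≢b = contradiction refl a≢b
  ind-≢ {zero}  {suc b} a≢b = refl
  ind-≢ {suc a} {zero}  a≢b = refl
  ind-≢ {suc a} {suc b} a≢b = ind-≢ (λ eq → a≢b (cong suc eq))

  T-0 : ∀ M {n} (f : Cube n) B → (∀ S → f S ≡ 0ℤ) → T M f B ≡ 0ℤ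
  T-0 M f B f≗0 = trans (T-cong M f≗0 B) (T-* M 0ℤ (λ _ → 0ℤ) B)

  D-0 : ∀ {n} (f : Cube n) B → (∀ S → ∣ S ∣ ≡ suc ∣ B ∣ → f S ≡ 0ℤ) → D f B ≡ 0ℤ
  D-0 f B f≗0 = trans (D-cong B f≗0) (D-* 0ℤ (λ _ → 0ℤ) B)

  -- B is its own only subset with |B| elements.
  X-diagonal : ∀ {n} (f : Cube n) B → X (ind ∣ B ∣ ◃ f) B ≡ f B
  X-diagonal f []            = ℤ.*-identityˡ (f [])
  X-diagonal f (outside ∷ B) = X-diagonal (lo f) B
  X-diagonal f (inside ∷ B)  = trans
    (cong₂ _+_
      (trans (X-cong-≤ B (λ S le → cong (_* lo f S) (ind-> (s≤s le)))) (T-* (leq ᵗ) 0ℤ (lo f) B))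
      (X-diagonal (hi f) B))
    (ℤ.+-identityˡ (hi f B))

  Y-diagonal : ∀ {n} (f : Cube n) A → Y (ind ∣ A ∣ ◃ f) A ≡ f A
  Y-diagonal f []            = ℤ.*-identityˡ (f [])
  Y-diagonal f (outside ∷ A) = trans
    (cong₂ _+_
      (Y-diagonal (lo f) A)
      (trans (Y-cong-≥ A (λ S le → cong (_* hi f S) (ind-< (s≤s le)))) (T-* leq 0ℤ (hi f) A)))
    (ℤ.+-identityʳ (lo f A))
  Y-diagonal f (inside ∷ A)  = Y-diagonal (hi f) A

  Harmonic : ∀ {n} → Cube n → Set
  Harmonic h = ∀ S → D h S ≡ 0ℤ

  -- `D` at B sees only sets of size |B| + 1, where the weight φ is constant.
  ◃-harmonic : ∀ φ {n} {h : Cube n} → Harmonic h → Harmonic (φ ◃ h)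
  ◃-harmonic φ {h = h} harm B = begin
    D (φ ◃ h) B                       ≡⟨ D-cong B (λ S eq → cong (λ s → φ s * h S) eq) ⟩
    D (λ S → φ (suc ∣ B ∣) * h S) B   ≡⟨ D-* (φ (suc ∣ B ∣)) h B ⟩
    φ (suc ∣ B ∣) * D h B             ≡⟨ cong (φ (suc ∣ B ∣) *_) (harm B) ⟩
    φ (suc ∣ B ∣) * 0ℤ                ≡⟨ ℤ.*-zeroʳ (φ (suc ∣ B ∣)) ⟩
    0ℤ                                ∎
    where open ≡-Reasoning

  -- As `D` at B sees only sets of size |B| + 1, the restriction to level k can fail to be harmonic
  -- only at sets with k - 1 elements.
  level-harmonic : ∀ k {n} (f : Cube n) → (∀ S → suc ∣ S ∣ ≡ k → D f S ≡ 0ℤ) → Harmonic (ind k ◃ f)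
  level-harmonic k f harm B with suc ∣ B ∣ ℕ.≟ k
  ... | yes refl = trans (D-cong B (λ S eq → trans (cong (λ s → ind (suc ∣ B ∣) s * f S) eq)
                         (trans (cong (_* f S) (ind-refl ∣ B ∣)) (ℤ.*-identityˡ (f S))))) (harm B refl)
  ... | no  ≢k   = D-0 (ind k ◃ f) B (λ S eq → cong (_* f S) (ind-≢ (λ k≡ → ≢k (sym (trans k≡ eq)))))

  -- Follows from `D-X`, whose term X (D (φ ◃ h)) is zero. The relation between the weights is ψ i =
  -- (n - |B| - i) φ i, written without subtraction.
  D-X-harmonic : ∀ {n} {h : Cube n} → Harmonic h → ∀ φ ψ B →
    (∀ i → i ℕ.≤ ∣ B ∣ → ψ i + (+ ∣ B ∣ + + i) * φ i ≡ + n * φ i) →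
    D (X (φ ◃ h)) B ≡ X (ψ ◃ h) B
  D-X-harmonic {n} {h} harm φ ψ B eq = cancel (D (X φh) B) (X (ψ ◃ h) B) (X (E φh) B) (+ ∣ B ∣ * X φh B) (begin
    D (X φh) B + X (E φh) B + + ∣ B ∣ * X φh B                ≡⟨ D-X φh B ⟩
    X (D φh) B + + n * X φh B
      ≡⟨ cong (_+ + n * X φh B) (T-0 (leq ᵗ) (D φh) B (◃-harmonic φ harm)) ⟩
    0ℤ + + n * X φh B                                         ≡⟨ ℤ.+-identityˡ (+ n * X φh B) ⟩
    + n * X φh B                                              ≡⟨ T-* (leq ᵗ) (+ n) φh B ⟨
    X (λ S → + n * φh S) B
      ≡⟨ X-cong-≤ B (λ S le → pointwise (ψ ∣ S ∣) (+ ∣ B ∣) (+ ∣ S ∣) (φ ∣ S ∣) (+ n) (h S) (eq ∣ S ∣ le)) ⟩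
    X (λ S → (ψ ◃ h) S + (E φh S + + ∣ B ∣ * φh S)) B
      ≡⟨ T-+ (leq ᵗ) (ψ ◃ h) (λ S → E φh S + + ∣ B ∣ * φh S) B ⟩
    X (ψ ◃ h) B + X (λ S → E φh S + + ∣ B ∣ * φh S) B
      ≡⟨ cong (λ x → X (ψ ◃ h) B + x) (T-+ (leq ᵗ) (E φh) (λ S → + ∣ B ∣ * φh S) B) ⟩
    X (ψ ◃ h) B + (X (E φh) B + X (λ S → + ∣ B ∣ * φh S) B)
      ≡⟨ cong (λ x → X (ψ ◃ h) B + (X (E φh) B + x)) (T-* (leq ᵗ) (+ ∣ B ∣) φh B) ⟩
    X (ψ ◃ h) B + (X (E φh) B + + ∣ B ∣ * X φh B) ∎)
    where
    open ≡-Reasoning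
    φh = φ ◃ h
    pointwise : ∀ p b i f m x → p + (b + i) * f ≡ m * f → m * (f * x) ≡ p * x + (i * (f * x) + b * (f * x))
    pointwise p b i f m x eq = begin
      m * (f * x)                         ≡⟨ ℤ.*-assoc m f x ⟨
      m * f * x                           ≡⟨ cong (_* x) eq ⟨
      (p + (b + i) * f) * x               ≡⟨ expand p b i f x ⟩
      p * x + (i * (f * x) + b * (f * x)) ∎
      where
      expand : ∀ p b i f x → (p + (b + i) * f) * x ≡ p * x + (i * (f * x) + b * (f * x))
      expand = solve-∀
    cancel : ∀ a b c d → a + c + d ≡ b + (c + d) → a ≡ b
    cancel a b c d eq = ∙-cancelʳ (c + d) a b (trans (sym (ℤ.+-assoc a c d)) eq)

  -- The integer n! / e replaces division by e for 1 ≤ e ≤ n, at the price of the common factor n!.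
  -- The value at e = 0 is a default.
  cofactor : ℕ → ℕ → ℕ
  cofactor n zero    = 0
  cofactor n (suc e) = n ! / suc e

  cofactor-* : ∀ n e → 0 ℕ.< e → e ℕ.≤ n → e ℕ.* cofactor n e ≡ n !
  cofactor-* n (suc e) _ e≤n =
    m*[n/m]≡n (∣-trans (divides (e !) (ℕ.*-comm (suc e) (e !))) (m≤n⇒m!∣n! e≤n))

  -- Scaling h by n!/(|S| - |A|) on level |S| keeps it harmonic and turns Y-D
  -- into the vanishing of the contribution of the proper supersets of A.
  Y-harmonic : ∀ {n} {h : Cube n} → Harmonic h → ∀ A → Y h A ≡ h A
  Y-harmonic {n} {h} harm A = cancel (Y h A) (h A) (begin
    + (n !) * (Y h A + -1ℤ * h A)
      ≡⟨ cong (λ x → + (n !) * (Y h A + -1ℤ * x)) (Y-diagonal h A) ⟨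
    + (n !) * (Y h A + -1ℤ * Y (ind j ◃ h) A)
      ≡⟨ cong (λ x → + (n !) * (Y h A + x)) (T-* leq -1ℤ (ind j ◃ h) A) ⟨
    + (n !) * (Y h A + Y (λ S → -1ℤ * (ind j ◃ h) S) A)
      ≡⟨ cong (+ (n !) *_) (T-+ leq h (λ S → -1ℤ * (ind j ◃ h) S) A) ⟨
    + (n !) * Y (λ S → h S + -1ℤ * (ind j ◃ h) S) A
      ≡⟨ T-* leq (+ (n !)) (λ S → h S + -1ℤ * (ind j ◃ h) S) A ⟨
    Y (λ S → + (n !) * (h S + -1ℤ * (ind j ◃ h) S)) A
      ≡⟨ Y-cong-≥ A (λ S le → pointwise S le) ⟩
    Y (λ S → E h′ S + - (+ j) * h′ S) A
      ≡⟨ T-+ leq (E h′) (λ S → - (+ j) * h′ S) A ⟩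
    Y (E h′) A + Y (λ S → - (+ j) * h′ S) A
      ≡⟨ cong₂ _+_ (sym (Y-D h′ A)) (T-* leq (- (+ j)) h′ A) ⟩
    Y (D h′) A + + j * Y h′ A + - (+ j) * Y h′ A
      ≡⟨ cong (λ x → x + + j * Y h′ A + - (+ j) * Y h′ A) (T-0 leq (D h′) A (◃-harmonic φ harm)) ⟩
    0ℤ + + j * Y h′ A + - (+ j) * Y h′ A
      ≡⟨ vanish (+ j) (Y h′ A) ⟩
    0ℤ ∎)
    where
    open ≡-Reasoning
    j = ∣ A ∣
    φ : ℕ → ℤ
    φ a = + cofactor n (a ∸ j)
    h′ = φ ◃ h
    vanish : ∀ b y → 0ℤ + b * y + - b * y ≡ 0ℤ
    vanish = solve-∀
    cancel : ∀ x y → + (n !) * (x + -1ℤ * y) ≡ 0ℤ → x ≡ y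
    cancel x y eq with ℤ.i*j≡0⇒i≡0∨j≡0 (+ (n !)) eq
    ... | inj₁ n!≡0 = contradiction (ℤ.+-injective n!≡0) (ℕ.≢-nonZero⁻¹ (n !) {{n !≢0}})
    ... | inj₂ eq′  = trans (rearrange x y) (trans (cong (_+ y) eq′) (ℤ.+-identityˡ y))
      where
      rearrange : ∀ x y → x ≡ x + -1ℤ * y + y
      rearrange = solve-∀
    pointwise : ∀ S → j ℕ.≤ ∣ S ∣ →
      + (n !) * (h S + -1ℤ * (ind j ◃ h) S) ≡ E h′ S + - (+ j) * h′ S
    pointwise S le with ℕ.m≤n⇒m<n∨m≡n le
    ... | inj₂ eq = begin
      + (n !) * (h S + -1ℤ * (ind j ∣ S ∣ * h S))
        ≡⟨ cong (λ s → + (n !) * (h S + -1ℤ * (ind j s * h S))) eq ⟨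
      + (n !) * (h S + -1ℤ * (ind j j * h S))
        ≡⟨ cong (λ x → + (n !) * (h S + -1ℤ * (x * h S))) (ind-refl j) ⟩
      + (n !) * (h S + -1ℤ * (1ℤ * h S))
        ≡⟨ ring (+ (n !)) (h S) (+ j) (φ j) ⟩
      + j * (φ j * h S) + - (+ j) * (φ j * h S)
        ≡⟨ cong (λ s → + s * (φ s * h S) + - (+ j) * (φ s * h S)) eq ⟩
      E h′ S + - (+ j) * h′ S ∎
      where
      ring : ∀ a x b c → a * (x + -1ℤ * (1ℤ * x)) ≡ b * (c * x) + - b * (c * x)
      ring = solve-∀
    ... | inj₁ lt = begin
      + (n !) * (h S + -1ℤ * (ind j ∣ S ∣ * h S))
        ≡⟨ cong (λ x → + (n !) * (h S + -1ℤ * (x * h S))) (ind-< lt) ⟩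
      + (n !) * (h S + -1ℤ * (0ℤ * h S))
        ≡⟨ cong (λ x → + x * (h S + -1ℤ * (0ℤ * h S)))
                (cofactor-* n e (ℕ.m<n⇒0<n∸m lt) (ℕ.≤-trans (ℕ.m∸n≤m ∣ S ∣ j) (∣p∣≤n S))) ⟨
      + (e ℕ.* cofactor n e) * (h S + -1ℤ * (0ℤ * h S))
        ≡⟨ cong (_* (h S + -1ℤ * (0ℤ * h S))) (ℤ.pos-* e (cofactor n e)) ⟩
      + e * φ ∣ S ∣ * (h S + -1ℤ * (0ℤ * h S))
        ≡⟨ ring (+ e) (φ ∣ S ∣) (h S) (+ j) ⟩
      (+ j + + e) * (φ ∣ S ∣ * h S) + - (+ j) * (φ ∣ S ∣ * h S)
        ≡⟨ cong (λ s → + s * h′ S + - (+ j) * h′ S) (ℕ.m+[n∸m]≡n le) ⟩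
      E h′ S + - (+ j) * h′ S ∎
      where
      e = ∣ S ∣ ∸ j
      ring : ∀ e c x b → e * c * (x + -1ℤ * (0ℤ * x)) ≡ (b + e) * (c * x) + - b * (c * x)
      ring = solve-∀

  -- Induction on k. The decomposition of D f on k-sets is lifted to a function h₁ with D (X h₁) = M
  -- (D f) there. Then u = M f - X h₁ is annihilated by `D` on k-sets, so its restriction to level k
  -- + 1 is harmonic and serves as the new top level. The factor N clears denominators.
  harmonic-decomposition : ∀ {n} k → k ℕ.+ k ℕ.≤ suc n → (f : Cube n) →
    ∃[ N ] ∃[ h ] NonZero N × Harmonic h × (∀ B → ∣ B ∣ ≡ k → + N * f B ≡ X h B)
  harmonic-decomposition zero _ f =
    1 , ind 0 ◃ f , _ , level-harmonic 0 f (λ _ ()) , λ B eq → begin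
      1ℤ * f B              ≡⟨ ℤ.*-identityˡ (f B) ⟩
      f B                   ≡⟨ X-diagonal f B ⟨
      X (ind ∣ B ∣ ◃ f) B   ≡⟨ cong (λ b → X (ind b ◃ f) B) eq ⟩
      X (ind 0 ◃ f) B       ∎
    where open ≡-Reasoning
  harmonic-decomposition {n} (suc k) 2k+2≤n+1 f with harmonic-decomposition k (ℕ.≤-trans (ℕ.+-mono-≤ (ℕ.n≤1+n k) (ℕ.n≤1+n k)) 2k+2≤n+1) (D f)
  ... | N , h , N≢0 , harm , eq =
    n ! ℕ.* N , (λ S → h₁ S + (ind (suc k) ◃ u) S) , ℕ.m*n≢0 (n !) N {{n !≢0}} {{N≢0}} ,
    (λ S → trans (D-+ h₁ (ind (suc k) ◃ u) S)
      (cong₂ _+_ (◃-harmonic φ harm S) (level-harmonic (suc k) u (λ S eq → u-harmonic S (ℕ.suc-injective eq)) S))) ,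
    λ B ∣B∣≡ → begin
      + M * f B                               ≡⟨ split (+ M * f B) (X h₁ B) ⟩
      X h₁ B + u B                            ≡⟨ cong (λ x → X h₁ B + x) (X-diagonal u B) ⟨
      X h₁ B + X (ind ∣ B ∣ ◃ u) B            ≡⟨ cong (λ b → X h₁ B + X (ind b ◃ u) B) ∣B∣≡ ⟩
      X h₁ B + X (ind (suc k) ◃ u) B          ≡⟨ T-+ (leq ᵗ) h₁ (ind (suc k) ◃ u) B ⟨
      X (λ S → h₁ S + (ind (suc k) ◃ u) S) B  ∎
    where
    open ≡-Reasoning
    M = n ! ℕ.* N
    φ : ℕ → ℤ
    -- On k-sets `D` after `X` multiplies the part on level i by n - k - i; this weight inverts that
    -- up to n!.
    φ i = + cofactor n (n ∸ (k ℕ.+ i))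
    h₁ = φ ◃ h
    u : Cube n
    u B = + M * f B + -1ℤ * X h₁ B
    split : ∀ a b → a ≡ b + (a + -1ℤ * b)
    split = solve-∀
    2k<n : k ℕ.+ k ℕ.< n
    2k<n = ℕ.s≤s⁻¹ (ℕ.≤-trans (ℕ.≤-reflexive (sym (cong suc (ℕ.+-suc k k)))) 2k+2≤n+1)
    weights : ∀ i → i ℕ.≤ k → + (n !) + (+ k + + i) * φ i ≡ + n * φ i
    weights i i≤k = begin
      + (n !) + + (k ℕ.+ i) * φ i
        ≡⟨ cong (λ x → + x + + (k ℕ.+ i) * φ i) (cofactor-* n e (ℕ.m<n⇒0<n∸m k+i<n) (ℕ.m∸n≤m n (k ℕ.+ i))) ⟨
      + (e ℕ.* cofactor n e) + + (k ℕ.+ i) * φ i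
        ≡⟨ cong (_+ + (k ℕ.+ i) * φ i) (ℤ.pos-* e (cofactor n e)) ⟩
      + e * φ i + + (k ℕ.+ i) * φ i
        ≡⟨ ℤ.*-distribʳ-+ (φ i) (+ e) (+ (k ℕ.+ i)) ⟨
      + (e ℕ.+ (k ℕ.+ i)) * φ i
        ≡⟨ cong (λ m → + m * φ i) (ℕ.m∸n+n≡m (ℕ.<⇒≤ k+i<n)) ⟩
      + n * φ i ∎
      where
      e = n ∸ (k ℕ.+ i)
      k+i<n : k ℕ.+ i ℕ.< n
      k+i<n = ℕ.≤-<-trans (ℕ.+-monoʳ-≤ k i≤k) 2k<n
    u-harmonic : ∀ S → ∣ S ∣ ≡ k → D u S ≡ 0ℤ
    u-harmonic S refl = begin
      D u S
        ≡⟨ D-+ (λ B → + M * f B) (λ B → -1ℤ * X h₁ B) S ⟩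
      D (λ B → + M * f B) S + D (λ B → -1ℤ * X h₁ B) S
        ≡⟨ cong₂ _+_ (D-* (+ M) f S) (D-* -1ℤ (X h₁) S) ⟩
      + M * D f S + -1ℤ * D (X h₁) S
        ≡⟨ cong (λ x → + M * D f S + -1ℤ * x) (D-X-harmonic harm φ (λ _ → + (n !)) S weights) ⟩
      + M * D f S + -1ℤ * X ((λ _ → + (n !)) ◃ h) S
        ≡⟨ cong₂ (λ x y → x * D f S + -1ℤ * y) (ℤ.pos-* (n !) N) (T-* (leq ᵗ) (+ (n !)) h S) ⟩
      + (n !) * + N * D f S + -1ℤ * (+ (n !) * X h S)
        ≡⟨ cong (λ x → + (n !) * + N * D f S + -1ℤ * (+ (n !) * x)) (eq S refl) ⟨
      + (n !) * + N * D f S + -1ℤ * (+ (n !) * (+ N * D f S))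
        ≡⟨ vanish (+ (n !)) (+ N) (D f S) ⟩
      0ℤ ∎
      where
      vanish : ∀ a b c → a * b * c + -1ℤ * (a * (b * c)) ≡ 0ℤ
      vanish = solve-∀

  -- The action of `X`, `Y` and `Z` on harmonic functions.

  ind-β : ∀ k s → ind k s ≡ + β 0 k s
  ind-β zero    zero    = refl
  ind-β (suc k) zero    = refl
  ind-β zero    (suc s) = refl
  ind-β (suc k) (suc s) = ind-β k s

  -- For I disjoint from B, the coefficient of g I counts the sets A that contain I, avoid B and
  -- satisfy s + |A| = k. The parameter s records the elements of A already fixed by earlier
  -- coordinates.
  Z-X : ∀ {n} k s (g : Cube n) B →
    Z (λ A → ind k (s ℕ.+ ∣ A ∣) * X g A) B
      ≡ Z (λ I → + β (n ∸ (∣ B ∣ ℕ.+ ∣ I ∣)) k (s ℕ.+ ∣ I ∣) * g I) B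
  Z-X k s g [] = cong (_* g []) (ind-β k (s ℕ.+ 0))
  Z-X {suc n} k s g (inside ∷ B) = Z-X k s (lo g) B
  Z-X {suc n} k s g (outside ∷ B) = begin
    Z p B + Z (λ A → ind k (s ℕ.+ suc ∣ A ∣) * (X (lo g) A + X (hi g) A)) B
      ≡⟨ cong (λ x → Z p B + x) (trans
           (T-cong disj (λ A → trans (cong (λ t → ind k t * (X (lo g) A + X (hi g) A)) (ℕ.+-suc s ∣ A ∣))
              (ℤ.*-distribˡ-+ (ind k (suc s ℕ.+ ∣ A ∣)) (X (lo g) A) (X (hi g) A))) B)
           (T-+ disj p′ q′ B)) ⟩
    Z p B + (Z p′ B + Z q′ B)
      ≡⟨ cong₂ _+_ (Z-X k s (lo g) B) (cong₂ _+_ (Z-X k (suc s) (lo g) B) (Z-X k (suc s) (hi g) B)) ⟩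
    Z r B + (Z r′ B + Z t B)
      ≡⟨ ℤ.+-assoc (Z r B) (Z r′ B) (Z t B) ⟨
    Z r B + Z r′ B + Z t B
      ≡⟨ cong (_+ Z t B) (T-+ disj r r′ B) ⟨
    Z (λ I → r I + r′ I) B + Z t B
      -- Pascal's rule for a first coordinate outside B and I, which may or may not lie in A. The
      -- sets I seen by `Z` satisfy |B| + |I| ≤ n, so the difference with n is genuine.
      ≡⟨ cong₂ _+_ (Z-cong-≤ B pascal) (T-cong disj shift B) ⟩
    Z (λ I → + β (suc n ∸ (∣ B ∣ ℕ.+ ∣ I ∣)) k (s ℕ.+ ∣ I ∣) * lo g I) B
    + Z (λ I → + β (suc n ∸ (∣ B ∣ ℕ.+ suc ∣ I ∣)) k (s ℕ.+ suc ∣ I ∣) * hi g I) B ∎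
    where
    open ≡-Reasoning
    p p′ q′ r r′ t : Cube n
    p A  = ind k (s ℕ.+ ∣ A ∣) * X (lo g) A
    p′ A = ind k (suc s ℕ.+ ∣ A ∣) * X (lo g) A
    q′ A = ind k (suc s ℕ.+ ∣ A ∣) * X (hi g) A
    r I  = + β (n ∸ (∣ B ∣ ℕ.+ ∣ I ∣)) k (s ℕ.+ ∣ I ∣) * lo g I
    r′ I = + β (n ∸ (∣ B ∣ ℕ.+ ∣ I ∣)) k (suc s ℕ.+ ∣ I ∣) * lo g I
    t I  = + β (n ∸ (∣ B ∣ ℕ.+ ∣ I ∣)) k (suc s ℕ.+ ∣ I ∣) * hi g I
    pascal : ∀ I → ∣ B ∣ ℕ.+ ∣ I ∣ ℕ.≤ n →
      r I + r′ I ≡ + β (suc n ∸ (∣ B ∣ ℕ.+ ∣ I ∣)) k (s ℕ.+ ∣ I ∣) * lo g I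
    pascal I le = trans
      (sym (ℤ.*-distribʳ-+ (lo g I) (+ β m k (s ℕ.+ ∣ I ∣)) (+ β m k (suc s ℕ.+ ∣ I ∣))))
      (cong (λ x → + x * lo g I) (trans (sym (β-pascal m k (s ℕ.+ ∣ I ∣)))
        (cong (λ x → β x k (s ℕ.+ ∣ I ∣)) (sym (ℕ.+-∸-assoc 1 le)))))
      where m = n ∸ (∣ B ∣ ℕ.+ ∣ I ∣)
    shift : ∀ I → t I ≡ + β (suc n ∸ (∣ B ∣ ℕ.+ suc ∣ I ∣)) k (s ℕ.+ suc ∣ I ∣) * hi g I
    shift I rewrite ℕ.+-suc ∣ B ∣ ∣ I ∣ | ℕ.+-suc s ∣ I ∣ = refl

  -- Inclusion-exclusion turns `Z` into `X` after a signed `Y`, and `Y` fixes harmonic functions.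
  -- For |B| = k the weights (-1)^i C(n - k - i, k - i) are the eigenvalues of the Kneser graph.
  Z-X-harmonic : ∀ {n} k {h : Cube n} → Harmonic h → ∀ B →
    Z (ind k ◃ X h) B ≡ X ((λ i → sgn i * + β (n ∸ (∣ B ∣ ℕ.+ i)) k i) ◃ h) B
  Z-X-harmonic {n} k {h} harm B = begin
    Z (ind k ◃ X h) B    ≡⟨ Z-X k 0 h B ⟩
    Z (c ◃ h) B          ≡⟨ Z-X-Y (c ◃ h) B ⟩
    X (sgn ◃ Y (c ◃ h)) B
      ≡⟨ T-cong (leq ᵗ) (λ S → trans (cong (sgn ∣ S ∣ *_) (Y-harmonic (◃-harmonic c harm) S))
                                     (sym (ℤ.*-assoc (sgn ∣ S ∣) (c ∣ S ∣) (h S)))) B ⟩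
    X ((λ i → sgn i * c i) ◃ h) B ∎
    where
    open ≡-Reasoning
    c : ℕ → ℤ
    c i = + β (n ∸ (∣ B ∣ ℕ.+ i)) k i

  -- Induction on m = k - |A|. As w lives on level k, `D-Y` gives D (Y w) A = (k - |A|) Y w A. The
  -- left side involves only sets with one more element, so the induction hypothesis and
  -- `D-X-harmonic` evaluate it; the weights match by absorption of binomial coefficients.
  Y-X-level : ∀ {n} k {h : Cube n} → Harmonic h → k ℕ.+ k ℕ.≤ n → ∀ m A → ∣ A ∣ ℕ.+ m ≡ k →
    Y (ind k ◃ X h) A ≡ X ((λ i → + ((n ∸ (∣ A ∣ ℕ.+ i)) C m)) ◃ h) A
  Y-X-level {n} k {h} harm 2k≤n zero A eq = begin
    Y (ind k ◃ X h) A       ≡⟨ cong (λ j → Y (ind j ◃ X h) A) (trans (sym eq) (ℕ.+-identityʳ ∣ A ∣)) ⟩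
    Y (ind ∣ A ∣ ◃ X h) A   ≡⟨ Y-diagonal (X h) A ⟩
    X h A                   ≡⟨ T-cong (leq ᵗ) (λ S → sym (ℤ.*-identityˡ (h S))) A ⟩
    X (λ S → 1ℤ * h S) A    ∎
    where open ≡-Reasoning
  Y-X-level {n} k {h} harm 2k≤n (suc m) A eq =
    ℤ.*-cancelˡ-≡ (+ suc m) (Y w A) (X ((λ i → + ((n ∸ (j ℕ.+ i)) C suc m)) ◃ h) A) (begin
      + suc m * Y w A
        ≡⟨ down ⟩
      D (Y w) A
        ≡⟨ D-cong A (λ S eq′ → trans
             (Y-X-level k harm 2k≤n m S (trans (cong (ℕ._+ m) eq′) (trans (sym (ℕ.+-suc j m)) eq)))
             (cong (λ s → X ((λ i → + ((n ∸ (s ℕ.+ i)) C m)) ◃ h) S) eq′)) ⟩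
      D (X ((λ i → + ((n ∸ (suc j ℕ.+ i)) C m)) ◃ h)) A
        ≡⟨ D-X-harmonic harm (λ i → + ((n ∸ (suc j ℕ.+ i)) C m)) (λ i → + suc m * + ((n ∸ (j ℕ.+ i)) C suc m)) A weights ⟩
      X ((λ i → + suc m * + ((n ∸ (j ℕ.+ i)) C suc m)) ◃ h) A
        ≡⟨ T-cong (leq ᵗ) (λ S → ℤ.*-assoc (+ suc m) (+ ((n ∸ (j ℕ.+ ∣ S ∣)) C suc m)) (h S)) A ⟩
      X (λ S → + suc m * (+ ((n ∸ (j ℕ.+ ∣ S ∣)) C suc m) * h S)) A
        ≡⟨ T-* (leq ᵗ) (+ suc m) ((λ i → + ((n ∸ (j ℕ.+ i)) C suc m)) ◃ h) A ⟩
      + suc m * X ((λ i → + ((n ∸ (j ℕ.+ i)) C suc m)) ◃ h) A ∎)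
    where
    open ≡-Reasoning
    j = ∣ A ∣
    w : Cube n
    w = ind k ◃ X h
    at-k : ∀ S → E w S ≡ + k * w S
    at-k S with k ℕ.≟ ∣ S ∣
    ... | yes refl = refl
    ... | no k≢    = trans (cong (λ x → + ∣ S ∣ * (x * X h S)) (ind-≢ k≢))
                    (trans (ℤ.*-zeroʳ (+ ∣ S ∣)) (sym (trans (cong (λ x → + k * (x * X h S)) (ind-≢ k≢)) (ℤ.*-zeroʳ (+ k)))))
    down : + suc m * Y w A ≡ D (Y w) A
    down = ∙-cancelʳ (+ j * Y w A) (+ suc m * Y w A) (D (Y w) A) (begin
      + suc m * Y w A + + j * Y w A   ≡⟨ ℤ.*-distribʳ-+ (Y w A) (+ suc m) (+ j) ⟨
      + (suc m ℕ.+ j) * Y w A         ≡⟨ cong (λ x → + x * Y w A) (trans (ℕ.+-comm (suc m) j) eq) ⟩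
      + k * Y w A                     ≡⟨ T-* leq (+ k) w A ⟨
      Y (λ S → + k * w S) A           ≡⟨ T-cong leq at-k A ⟨
      Y (E w) A                       ≡⟨ D-Y w A ⟨
      D (Y w) A + + j * Y w A         ∎)
    weights : ∀ i → i ℕ.≤ j →
      + suc m * + ((n ∸ (j ℕ.+ i)) C suc m) + (+ j + + i) * + ((n ∸ (suc j ℕ.+ i)) C m)
        ≡ + n * + ((n ∸ (suc j ℕ.+ i)) C m)
    weights i i≤j = begin
      + suc m * + ((n ∸ (j ℕ.+ i)) C suc m) + + (j ℕ.+ i) * + (M C m)
        ≡⟨ cong (λ x → + suc m * + (x C suc m) + + (j ℕ.+ i) * + (M C m)) n∸ ⟩
      + suc m * + (suc M C suc m) + + (j ℕ.+ i) * + (M C m)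
        ≡⟨ cong₂ _+_ (sym (ℤ.pos-* (suc m) (suc M C suc m))) (sym (ℤ.pos-* (j ℕ.+ i) (M C m))) ⟩
      + (suc m ℕ.* (suc M C suc m) ℕ.+ (j ℕ.+ i) ℕ.* (M C m))
        ≡⟨ cong (λ x → + (x ℕ.+ (j ℕ.+ i) ℕ.* (M C m))) (C-absorption M m) ⟩
      + (suc M ℕ.* (M C m) ℕ.+ (j ℕ.+ i) ℕ.* (M C m))
        ≡⟨ cong +_ (ℕ.*-distribʳ-+ (M C m) (suc M) (j ℕ.+ i)) ⟨
      + ((suc M ℕ.+ (j ℕ.+ i)) ℕ.* (M C m))
        ≡⟨ cong (λ x → + (x ℕ.* (M C m))) (trans (sym (ℕ.+-suc M (j ℕ.+ i))) (ℕ.m∸n+n≡m j+i<n)) ⟩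
      + (n ℕ.* (M C m))
        ≡⟨ ℤ.pos-* n (M C m) ⟩
      + n * + (M C m) ∎
      where
      M = n ∸ (suc j ℕ.+ i)
      j<k : j ℕ.< k
      j<k = ℕ.≤-trans (ℕ.m≤m+n (suc j) m) (ℕ.≤-reflexive (trans (sym (ℕ.+-suc j m)) eq))
      j+i<n : j ℕ.+ i ℕ.< n
      j+i<n = ℕ.≤-trans (ℕ.+-mono-≤ j<k (ℕ.≤-trans i≤j (ℕ.<⇒≤ j<k))) 2k≤n
      n∸ : n ∸ (j ℕ.+ i) ≡ suc M
      n∸ = ℕ.+-∸-assoc 1 j+i<n

  Y-X-harmonic : ∀ {n} k {h : Cube n} → Harmonic h → k ℕ.+ k ℕ.≤ n → ∀ A →
    Y (ind k ◃ X h) A ≡ X ((λ i → + β (n ∸ (∣ A ∣ ℕ.+ i)) k ∣ A ∣) ◃ h) A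
  Y-X-harmonic {n} k {h} harm 2k≤n A with ℕ.≤-<-connex ∣ A ∣ k
  ... | inj₁ j≤k = trans (Y-X-level k harm 2k≤n (k ∸ ∣ A ∣) A (ℕ.m+[n∸m]≡n j≤k))
    (T-cong (leq ᵗ) (λ S → cong (λ x → + x * h S) (sym (β-C (n ∸ (∣ A ∣ ℕ.+ ∣ S ∣)) j≤k))) A)
  ... | inj₂ k<j = begin
    Y (ind k ◃ X h) A
      ≡⟨ Y-cong-≥ A (λ S le → cong (_* X h S) (ind-< (ℕ.≤-trans k<j le))) ⟩
    Y (λ S → 0ℤ * X h S) A                  ≡⟨ T-* leq 0ℤ (X h) A ⟩
    0ℤ                                      ≡⟨ T-* (leq ᵗ) 0ℤ h A ⟨
    X (λ S → 0ℤ * h S) A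
      ≡⟨ T-cong (leq ᵗ) (λ S → cong (λ x → + x * h S) (sym (β-0 (n ∸ (∣ A ∣ ℕ.+ ∣ S ∣)) k<j))) A ⟩
    X ((λ i → + β (n ∸ (∣ A ∣ ℕ.+ i)) k ∣ A ∣) ◃ h) A ∎
    where open ≡-Reasoning

  -- Moving `X` off g leaves `Y` of the level-k part of X h, which `Y-X-harmonic` writes as `X` of a
  -- weighted h. Moving this `X` back leaves `Y` of a weighted g, which `Y-harmonic` removes. Hence
  -- no cross terms remain.
  gram : ∀ {n} k {g h : Cube n} → Harmonic g → Harmonic h → k ℕ.+ k ℕ.≤ n →
    ∑ (λ B → ind k ∣ B ∣ * (X g B * X h B)) ≡ ∑ (λ S → + β (n ∸ (∣ S ∣ ℕ.+ ∣ S ∣)) k ∣ S ∣ * (g S * h S))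
  gram {n} k {g} {h} harm-g harm-h 2k≤n = begin
    ∑ (λ B → ind k ∣ B ∣ * (X g B * X h B))
      ≡⟨ ∑-cong (λ B → trans (comm (ind k ∣ B ∣) (X g B) (X h B)) (sym (T-* (leq ᵗ) (w B) g B))) ⟩
    ∑ (λ B → X (λ I → w B * g I) B)
      ≡⟨ ∑-transpose (leq ᵗ) (λ B I → w B * g I) ⟩
    ∑ (λ I → Y (λ B → w B * g I) I)
      ≡⟨ ∑-cong (λ I → trans (T-cong leq (λ B → ℤ.*-comm (w B) (g I)) I) (T-* leq (g I) w I)) ⟩
    ∑ (λ I → g I * Y w I)
      ≡⟨ ∑-cong (λ I → trans (cong (g I *_) (Y-X-harmonic k harm-h 2k≤n I)) (sym (T-* (leq ᵗ) (g I) (c I ◃ h) I))) ⟩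
    ∑ (λ I → X (λ S → g I * (c I ∣ S ∣ * h S)) I)
      ≡⟨ ∑-transpose (leq ᵗ) (λ I S → g I * (c I ∣ S ∣ * h S)) ⟩
    ∑ (λ S → Y (λ I → g I * (c I ∣ S ∣ * h S)) S)
      ≡⟨ ∑-cong (λ S → trans (T-cong leq (λ I → comm′ (g I) (c I ∣ S ∣) (h S)) S)
                             (T-* leq (h S) (λ I → c I ∣ S ∣ * g I) S)) ⟩
    ∑ (λ S → h S * Y (c′ S ◃ g) S)
      ≡⟨ ∑-cong (λ S → trans (cong (h S *_) (Y-harmonic (◃-harmonic (c′ S) harm-g) S))
                             (assoc (h S) (c′ S ∣ S ∣) (g S))) ⟩
    ∑ (λ S → + β (n ∸ (∣ S ∣ ℕ.+ ∣ S ∣)) k ∣ S ∣ * (g S * h S)) ∎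
    where
    open ≡-Reasoning
    w : Cube n
    w = ind k ◃ X h
    c : Subset n → ℕ → ℤ
    c I i = + β (n ∸ (∣ I ∣ ℕ.+ i)) k ∣ I ∣
    -- The coefficient `c I ∣ S ∣` read as a weight in the size of I for fixed S.
    c′ : Subset n → ℕ → ℤ
    c′ S i = + β (n ∸ (i ℕ.+ ∣ S ∣)) k i
    comm : ∀ a x y → a * (x * y) ≡ (a * y) * x
    comm = solve-∀
    assoc : ∀ z a x → z * (a * x) ≡ a * (x * z)
    assoc = solve-∀
    comm′ : ∀ x a y → x * (a * y) ≡ y * (a * x)
    comm′ = solve-∀

  -- Positivity of the quadratic form.

  ∑-mono : ∀ {n} {f g : Cube n} → (∀ S → f S ≤ g S) → ∑ f ≤ ∑ g
  ∑-mono {zero}  f≤g = f≤g []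
  ∑-mono {suc n} f≤g = ℤ.+-mono-≤ (∑-mono (λ S → f≤g (false ∷ S))) (∑-mono (λ S → f≤g (true ∷ S)))

  -- Allows an equation to be used under the assumption that the set lies on level k.
  ind-cong : ∀ k j {x y : ℤ} → (j ≡ k → x ≡ y) → ind k j * x ≡ ind k j * y
  ind-cong k j {x} {y} x≡y with k ℕ.≟ j
  ... | yes k≡j = cong (ind k j *_) (x≡y (sym k≡j))
  ... | no  k≢j = trans (cong (_* x) (ind-≢ k≢j)) (cong (_* y) (sym (ind-≢ k≢j)))

  ind-idem : ∀ k j x → ind k j * (ind k j * x) ≡ ind k j * x
  ind-idem k j x = ind-cong k j (λ j≡k → trans (cong (λ i → ind k i * x) j≡k) (trans (cong (_* x) (ind-refl k)) (ℤ.*-identityˡ x)))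

  square≥0 : ∀ i → 0ℤ ≤ i * i
  square≥0 (+ n)      = subst (0ℤ ≤_) (ℤ.pos-* n n) (+≤+ z≤n)
  square≥0 (-[1+ n ]) = +≤+ z≤n

  *-nonneg : ∀ {i j} → 0ℤ ≤ i → 0ℤ ≤ j → 0ℤ ≤ i * j
  *-nonneg {+ m} {+ n} _ _ = subst (0ℤ ≤_) (ℤ.pos-* m n) (+≤+ z≤n)

  module Spectral (n k d : ℕ) (d<k : d ℕ.< k) (2≤d : 2 ℕ.≤ d) (bound : 2 ℕ.* k ℕ.+ 2 ℕ.* d ℕ.≤ 3 ℕ.+ n) where

    open Coefficients n k d d<k 2≤d bound

    2k≤n : k ℕ.+ k ℕ.≤ n
    2k≤n = ℕ.<⇒≤ 2k<n

    -- `γ` gives the weights of `Y` from k-sets to d-sets, and `ζ j` those of `Z` from k-sets to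
    -- j-sets, on harmonic levels.
    γ : ℕ → ℤ
    γ i = + ((n ∸ (d ℕ.+ i)) C (k ∸ d))

    ζ : ℕ → ℕ → ℤ
    ζ j i = sgn i * + β (n ∸ (j ℕ.+ i)) k i

    module _ (h : Cube n) (harm : Harmonic h) where

      private
        F : Cube n
        F = ind k ◃ X h

      F-F : ∑ (λ S → F S * F S) ≡ ∑ (λ S → + β (n ∸ (∣ S ∣ ℕ.+ ∣ S ∣)) k ∣ S ∣ * (h S * h S))
      F-F = trans (∑-cong (λ S → trans (r (ind k ∣ S ∣) (X h S)) (ind-idem k ∣ S ∣ (X h S * X h S))))
                  (gram k harm harm 2k≤n)
        where
        r : ∀ a x → (a * x) * (a * x) ≡ a * (a * (x * x))
        r = solve-∀

      F-ZF : ∑ (λ S → F S * Z F S) ≡ ∑ (λ S → + β (n ∸ (∣ S ∣ ℕ.+ ∣ S ∣)) k ∣ S ∣ * (h S * (ζ k ◃ h) S))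
      F-ZF = trans
        (∑-cong (λ S → trans (ℤ.*-assoc (ind k ∣ S ∣) (X h S) (Z F S)) (ind-cong k ∣ S ∣ (λ S≡k →
          cong (X h S *_) (trans (Z-X-harmonic k harm S) (cong (λ j → X (ζ j ◃ h) S) S≡k))))))
        (gram k harm (◃-harmonic (ζ k) harm) 2k≤n)

      YF-ZF : ∑ (λ S → ind d ∣ S ∣ * (Y F S * Z F S))
        ≡ ∑ (λ S → + β (n ∸ (∣ S ∣ ℕ.+ ∣ S ∣)) d ∣ S ∣ * ((γ ◃ h) S * (ζ d ◃ h) S))
      YF-ZF = trans
        (∑-cong (λ S → ind-cong d ∣ S ∣ (λ S≡d → cong₂ _*_ (YF S S≡d)
          (trans (Z-X-harmonic k harm S) (cong (λ j → X (ζ j ◃ h) S) S≡d)))))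
        (gram d (◃-harmonic γ harm) (◃-harmonic (ζ d) harm) 2d≤n)
        where
        YF : ∀ S → ∣ S ∣ ≡ d → Y F S ≡ X (γ ◃ h) S
        YF S refl = trans (Y-X-harmonic k harm 2k≤n S)
          (T-cong (leq ᵗ) (λ I → cong (λ x → + x * h I) (β-C (n ∸ (d ℕ.+ ∣ I ∣)) (ℕ.<⇒≤ d<k))) S)

      -- The difference of the two sides is the eigenvalue times the Gram weight `G` times a square.
      -- For s > k the Gram weight is zero.
      pointwise : ∀ s x →
        + L₀ * (+ β (n ∸ (s ℕ.+ s)) d s * ((γ s * x) * (ζ d s * x)))
          ≤ + c * (+ β (n ∸ (s ℕ.+ s)) k s * (x * x)) + + L * (+ β (n ∸ (s ℕ.+ s)) k s * (x * (ζ k s * x)))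
      pointwise s x = ℤ.0≤i-j⇒j≤i (subst (0ℤ ≤_) (sym difference) (nonneg (ℕ.≤-<-connex s k)))
        where
        G = β (n ∸ (s ℕ.+ s)) k s
        K = β (n ∸ (k ℕ.+ s)) k s
        H = β (n ∸ (s ℕ.+ s)) d s
        g = (n ∸ (d ℕ.+ s)) C (k ∸ d)
        W = β (n ∸ (d ℕ.+ s)) k s
        b′ = β (n ∸ (k ℕ.+ s)) d s ℕ.* g
        exchange′ : + H * + g * + W ≡ + G * + b′
        exchange′ = trans (cong (_* + W) (sym (ℤ.pos-* H g))) (trans (sym (ℤ.pos-* (H ℕ.* g) W))
          (trans (cong +_ (exchange s)) (ℤ.pos-* G b′)))
        difference : (+ c * (+ G * (x * x)) + + L * (+ G * (x * (sgn s * + K * x))))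
            - + L₀ * (+ H * ((+ g * x) * (sgn s * + W * x)))
          ≡ eigenvalue s * (+ G * (x * x))
        difference = begin
          _ ≡⟨ r₁ (+ c) (+ G) x (+ L) (sgn s) (+ K) (+ L₀) (+ H) (+ g) (+ W) ⟩
          (+ c + sgn s * (+ L * + K)) * (+ G * (x * x)) - + L₀ * sgn s * (x * x) * (+ H * + g * + W)
            ≡⟨ cong₂ (λ u v → (+ c + sgn s * u) * (+ G * (x * x)) - + L₀ * sgn s * (x * x) * v)
                     (sym (ℤ.pos-* L K)) exchange′ ⟩
          (+ c + sgn s * + a s) * (+ G * (x * x)) - + L₀ * sgn s * (x * x) * (+ G * + b′)
            ≡⟨ r₂ (+ c) (sgn s) (+ a s) (+ G) x (+ L₀) (+ b′) ⟩
          (+ c + sgn s * (+ a s - + L₀ * + b′)) * (+ G * (x * x))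
            ≡⟨ cong (λ u → (+ c + sgn s * (+ a s - u)) * (+ G * (x * x))) (ℤ.pos-* L₀ b′) ⟨
          eigenvalue s * (+ G * (x * x)) ∎
          where
          open ≡-Reasoning
          r₁ : ∀ c G x L s K L₀ H g W →
            (c * (G * (x * x)) + L * (G * (x * (s * K * x)))) - L₀ * (H * ((g * x) * (s * W * x)))
            ≡ (c + s * (L * K)) * (G * (x * x)) - L₀ * s * (x * x) * (H * g * W)
          r₁ = solve-∀
          r₂ : ∀ c s a G x L₀ b → (c + s * a) * (G * (x * x)) - L₀ * s * (x * x) * (G * b)
            ≡ (c + s * (a - L₀ * b)) * (G * (x * x))
          r₂ = solve-∀
        nonneg : _ → 0ℤ ≤ eigenvalue s * (+ G * (x * x))
        nonneg (inj₁ s≤k) = *-nonneg (eigenvalue≥0 s s≤k) (*-nonneg {+ G} (+≤+ z≤n) (square≥0 x))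
        nonneg (inj₂ k<s) = ℤ.≤-reflexive (sym (trans
          (cong (λ u → eigenvalue s * (+ u * (x * x))) (β-0 (n ∸ (s ℕ.+ s)) k<s))
          (ℤ.*-zeroʳ (eigenvalue s))))

      spectral-F : + L₀ * ∑ (λ S → ind d ∣ S ∣ * (Y F S * Z F S))
        ≤ + c * ∑ (λ S → F S * F S) + + L * ∑ (λ S → F S * Z F S)
      spectral-F = begin
        + L₀ * ∑ (λ S → ind d ∣ S ∣ * (Y F S * Z F S))
          ≡⟨ cong (+ L₀ *_) YF-ZF ⟩
        + L₀ * ∑ u₀
          ≡⟨ ∑-* (+ L₀) u₀ ⟨
        ∑ (λ S → + L₀ * u₀ S)
          ≤⟨ ∑-mono (λ S → pointwise ∣ S ∣ (h S)) ⟩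
        ∑ (λ S → + c * u₁ S + + L * u₂ S)
          ≡⟨ ∑-+ (λ S → + c * u₁ S) (λ S → + L * u₂ S) ⟩
        ∑ (λ S → + c * u₁ S) + ∑ (λ S → + L * u₂ S)
          ≡⟨ cong₂ _+_ (∑-* (+ c) u₁) (∑-* (+ L) u₂) ⟩
        + c * ∑ u₁ + + L * ∑ u₂
          ≡⟨ cong₂ (λ x y → + c * x + + L * y) F-F F-ZF ⟨
        + c * ∑ (λ S → F S * F S) + + L * ∑ (λ S → F S * Z F S) ∎
        where
        open ℤ.≤-Reasoning
        u₀ u₁ u₂ : Cube n
        u₀ S = + β (n ∸ (∣ S ∣ ℕ.+ ∣ S ∣)) d ∣ S ∣ * ((γ ◃ h) S * (ζ d ◃ h) S)
        u₁ S = + β (n ∸ (∣ S ∣ ℕ.+ ∣ S ∣)) k ∣ S ∣ * (h S * h S)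
        u₂ S = + β (n ∸ (∣ S ∣ ℕ.+ ∣ S ∣)) k ∣ S ∣ * (h S * (ζ k ◃ h) S)

    -- Both sides are homogeneous of degree two, so f may be replaced by N f = X h on k-sets and the
    -- factor N² cancelled at the end.
    spectral : (f : Cube n) → (∀ S → ∣ S ∣ ≢ k → f S ≡ 0ℤ) →
      + L₀ * ∑ (λ S → ind d ∣ S ∣ * (Y f S * Z f S))
        ≤ + c * ∑ (λ S → f S * f S) + + L * ∑ (λ S → f S * Z f S)
    spectral f supp with harmonic-decomposition k (ℕ.m≤n⇒m≤1+n 2k≤n) f
    ... | N@(suc _) , h , _ , harm , eq = ℤ.*-cancelˡ-≤-pos _ _ (+ N * + N) (begin
      M * (+ L₀ * ∑ (λ S → ind d ∣ S ∣ * (Y f S * Z f S)))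
        ≡⟨ r₁ M (+ L₀) (∑ (λ S → ind d ∣ S ∣ * (Y f S * Z f S))) ⟩
      + L₀ * (M * ∑ (λ S → ind d ∣ S ∣ * (Y f S * Z f S)))
        ≡⟨ cong (+ L₀ *_) (trans (sym (∑-* M (λ S → ind d ∣ S ∣ * (Y f S * Z f S)))) (∑-cong (λ S →
             trans (r₂ (+ N) (ind d ∣ S ∣) (Y f S) (Z f S))
                   (cong₂ (λ y z → ind d ∣ S ∣ * (y * z)) (T-F leq S) (T-F disj S))))) ⟩
      + L₀ * ∑ (λ S → ind d ∣ S ∣ * (Y F S * Z F S))
        ≤⟨ spectral-F h harm ⟩
      + c * ∑ (λ S → F S * F S) + + L * ∑ (λ S → F S * Z F S)
        ≡⟨ cong₂ (λ x y → + c * x + + L * y)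
             (trans (sym (∑-* M (λ S → f S * f S))) (∑-cong (λ S →
               trans (r₃ (+ N) (f S) (f S)) (cong₂ _*_ (f-F S) (f-F S)))))
             (trans (sym (∑-* M (λ S → f S * Z f S))) (∑-cong (λ S →
               trans (r₃ (+ N) (f S) (Z f S)) (cong₂ _*_ (f-F S) (T-F disj S))))) ⟨
      + c * (M * ∑ (λ S → f S * f S)) + + L * (M * ∑ (λ S → f S * Z f S))
        ≡⟨ r₄ M (+ c) (∑ (λ S → f S * f S)) (+ L) (∑ (λ S → f S * Z f S)) ⟩
      M * (+ c * ∑ (λ S → f S * f S) + + L * ∑ (λ S → f S * Z f S)) ∎)
      where
      open ℤ.≤-Reasoning
      M : ℤ
      M = + N * + N
      F : Cube n
      F = ind k ◃ X h
      f-F : ∀ S → + N * f S ≡ F S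
      f-F S with ∣ S ∣ ℕ.≟ k
      ... | yes S≡k = trans (eq S S≡k) (sym (trans (cong (_* X h S) (trans (cong (ind k) S≡k) (ind-refl k))) (ℤ.*-identityˡ (X h S))))
      ... | no  S≢k = trans (cong (+ N *_) (supp S S≢k)) (trans (ℤ.*-zeroʳ (+ N)) (sym (cong (_* X h S) (ind-≢ (S≢k ∘ sym)))))
      T-F : ∀ m S → + N * T m f S ≡ T m F S
      T-F m S = trans (sym (T-* m (+ N) f S)) (T-cong m f-F S)
      r₁ : ∀ m l x → m * (l * x) ≡ l * (m * x)
      r₁ = solve-∀
      r₂ : ∀ n i y z → n * n * (i * (y * z)) ≡ i * ((n * y) * (n * z))
      r₂ = solve-∀
      r₃ : ∀ n y z → n * n * (y * z) ≡ (n * y) * (n * z)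
      r₃ = solve-∀
      r₄ : ∀ m c x l y → c * (m * x) + l * (m * y) ≡ m * (c * x + l * y)
      r₄ = solve-∀

  -- Characteristic functions of families and double counting.

  Z-nonneg : ∀ {n} (f : Cube n) B → (∀ S → 0ℤ ≤ f S) → 0ℤ ≤ Z f B
  Z-nonneg f []            0≤f = 0≤f []
  Z-nonneg f (outside ∷ B) 0≤f =
    ℤ.+-mono-≤ (Z-nonneg (lo f) B (λ S → 0≤f (outside ∷ S))) (Z-nonneg (hi f) B (λ S → 0≤f (inside ∷ S)))
  Z-nonneg f (inside ∷ B)  0≤f = Z-nonneg (lo f) B (λ S → 0≤f (outside ∷ S))

  Empty-∷ : ∀ {n} {p : Subset n} → Empty p → Empty (outside ∷ p)
  Empty-∷ empty (suc x , x∈p) = empty (x , drop-there x∈p)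

  Z-0 : ∀ {n} (f : Cube n) B → (∀ A → Empty (A ∩ B) → f A ≡ 0ℤ) → Z f B ≡ 0ℤ
  Z-0 f []            f≡0 = f≡0 [] λ ()
  Z-0 f (outside ∷ B) f≡0 = cong₂ _+_
    (Z-0 (lo f) B (λ A → f≡0 (outside ∷ A) ∘ Empty-∷)) (Z-0 (hi f) B (λ A → f≡0 (inside ∷ A) ∘ Empty-∷))
  Z-0 f (inside ∷ B)  f≡0 = Z-0 (lo f) B (λ A → f≡0 (outside ∷ A) ∘ Empty-∷)

  -- Counts the sets disjoint from A with d - s elements; s records elements already chosen in
  -- earlier coordinates.
  Z-ind : ∀ {n} d s (A : Subset n) → Z (λ D → ind d (s ℕ.+ ∣ D ∣)) A ≡ + β (n ∸ ∣ A ∣) d s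
  Z-ind d s [] = trans (cong (ind d) (ℕ.+-identityʳ s)) (ind-β d s)
  Z-ind d s (inside ∷ A) = Z-ind d s A
  Z-ind {suc n} d s (outside ∷ A) = begin
    Z (λ D → ind d (s ℕ.+ ∣ D ∣)) A + Z (λ D → ind d (s ℕ.+ suc ∣ D ∣)) A
      ≡⟨ cong₂ _+_ (Z-ind d s A) (trans (T-cong disj (λ D → cong (ind d) (ℕ.+-suc s ∣ D ∣)) A) (Z-ind d (suc s) A)) ⟩
    + (β (n ∸ ∣ A ∣) d s ℕ.+ β (n ∸ ∣ A ∣) d (suc s))
      ≡⟨ cong +_ (β-pascal (n ∸ ∣ A ∣) d s) ⟨
    + β (suc (n ∸ ∣ A ∣)) d s
      ≡⟨ cong (λ m → + β m d s) (ℕ.+-∸-assoc 1 (∣p∣≤n A)) ⟨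
    + β (suc n ∸ ∣ A ∣) d s ∎
    where open ≡-Reasoning

  length-filter-map : ∀ {A B : Set} {P : B → Set} (P? : Decidable P) (f : A → B) xs →
    length (filter P? (map f xs)) ≡ length (filter (P? ∘ f) xs)
  length-filter-map P? f []       = refl
  length-filter-map P? f (x ∷ xs) with does (P? (f x))
  ... | true  = cong suc (length-filter-map P? f xs)
  ... | false = length-filter-map P? f xs

  count-∑ : ∀ {n} {P : Subset n → Set} (P? : Decidable P) →
    + length (filter P? (subsets n)) ≡ ∑ (λ S → gate (does (P? S)) 1ℤ)
  count-∑ {zero} P? with does (P? [])
  ... | true  = refl
  ... | false = refl
  count-∑ {suc n} P? = begin
    + length (filter P? (map (outside ∷_) (subsets n) ++ map (inside ∷_) (subsets n)))
      ≡⟨ cong (+_ ∘ length) (filter-++ P? (map (outside ∷_) (subsets n)) (map (inside ∷_) (subsets n))) ⟩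
    + length (filter P? (map (outside ∷_) (subsets n)) ++ filter P? (map (inside ∷_) (subsets n)))
      ≡⟨ cong +_ (length-++ (filter P? (map (outside ∷_) (subsets n)))) ⟩
    + (length (filter P? (map (outside ∷_) (subsets n))) ℕ.+ length (filter P? (map (inside ∷_) (subsets n))))
      ≡⟨ cong₂ (λ x y → + (x ℕ.+ y)) (length-filter-map P? (outside ∷_) (subsets n)) (length-filter-map P? (inside ∷_) (subsets n)) ⟩
    + length (filter (P? ∘ (outside ∷_)) (subsets n)) + + length (filter (P? ∘ (inside ∷_)) (subsets n))
      ≡⟨ cong₂ _+_ (count-∑ (P? ∘ (outside ∷_))) (count-∑ (P? ∘ (inside ∷_))) ⟩
    ∑ (λ S → gate (does (P? S)) 1ℤ) ∎
    where open ≡-Reasoning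

  Y-∑ : ∀ {n} (f : Cube n) A → Y f A ≡ ∑ (λ S → gate (does (A ⊆? S)) (f S))
  Y-∑ f []            = refl
  Y-∑ f (outside ∷ A) = cong₂ _+_ (Y-∑ (lo f) A) (Y-∑ (hi f) A)
  Y-∑ {suc n} f (inside ∷ A)  = trans (Y-∑ (hi f) A) (trans (sym (ℤ.+-identityˡ _)) (cong (_+ ∑ (λ S → gate (does (A ⊆? S)) (hi f S))) (sym (∑-0 n))))

  ∈-subsets : ∀ {n} (S : Subset n) → S ∈ subsets n
  ∈-subsets []            = here refl
  ∈-subsets (outside ∷ S) = ∈-++⁺ˡ (∈-map⁺ (outside ∷_) (∈-subsets S))
  ∈-subsets {suc n} (inside ∷ S) = ∈-++⁺ʳ (map (outside ∷_) (subsets n)) (∈-map⁺ (inside ∷_) (∈-subsets S))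

  χ : ∀ {n} → Family n → Cube n
  χ F S = gate (does (S ∈ᶠ? F)) 1ℤ

  χ-size : ∀ {n} (F : Family n) → ∑ (χ F) ≡ + size F
  χ-size F = sym (count-∑ (_∈ᶠ? F))

  χ-degree : ∀ {n} (F : Family n) S → Y (χ F) S ≡ + degree F S
  χ-degree F S = trans (Y-∑ (χ F) S) (trans
    (∑-cong (λ A → gate-∧ (does (S ⊆? A)) (does (A ∈ᶠ? F))))
    (sym (count-∑ (λ A → (S ⊆? A) ×-dec (A ∈ᶠ? F)))))
    where
    gate-∧ : ∀ b c → gate b (gate c 1ℤ) ≡ gate (b ∧ c) 1ℤ
    gate-∧ true  c = refl
    gate-∧ false c = refl

  χ-nonneg : ∀ {n} (F : Family n) S → 0ℤ ≤ χ F S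
  χ-nonneg F S with does (S ∈ᶠ? F)
  ... | true  = +≤+ z≤n
  ... | false = +≤+ z≤n

  χ-square : ∀ {n} (F : Family n) S → χ F S * χ F S ≡ χ F S
  χ-square F S with does (S ∈ᶠ? F)
  ... | true  = refl
  ... | false = refl

  χ-support : ∀ {n k} (F : Family n) → Uniform k F → ∀ S → ∣ S ∣ ≢ k → χ F S ≡ 0ℤ
  χ-support F uniform S S≢k with S ∈ᶠ? F
  ... | yes S∈F = contradiction (uniform S S∈F) S≢k
  ... | no  _   = refl

  -- No member of F is disjoint from S if S is in F. This removes the term with factor `L` from the
  -- spectral inequality.
  χ-Z : ∀ {n} (F : Family n) → Intersecting F → ∀ S → χ F S * Z (χ F) S ≡ 0ℤ
  χ-Z F intersecting S with S ∈ᶠ? F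
  ... | no  _   = refl
  ... | yes S∈F = trans (ℤ.*-identityˡ (Z (χ F) S)) (Z-0 (χ F) S disjoint)
    where
    disjoint : ∀ A → Empty (A ∩ S) → χ F A ≡ 0ℤ
    disjoint A empty with A ∈ᶠ? F
    ... | yes A∈F = contradiction (intersecting A S A∈F S∈F) empty
    ... | no  _   = refl

  -- Settles the empty family, for which the size cannot be cancelled.
  δ≤size : ∀ {n} d (F : Family n) → δ d F ℕ.≤ size F
  δ≤size d F = min≤⊤ (size F) (map (degree F) (filter (λ S → ∣ S ∣ ℕ.≟ d) (subsets _)))

  δ≤degree : ∀ {n} (F : Family n) S → δ ∣ S ∣ F ℕ.≤ degree F S
  δ≤degree F S = min≤v⁺ (size F) _ (inj₂ (lose
    (∈-map⁺ (degree F) (∈-filter⁺ (λ A → ∣ A ∣ ℕ.≟ ∣ S ∣) (∈-subsets S) refl)) ℕ.≤-refl))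

  -- After exchanging the sums, each k-set A is weighted by the number of d-sets disjoint from it.
  ∑-ind-Z : ∀ {n} k d (f : Cube n) → (∀ S → ∣ S ∣ ≢ k → f S ≡ 0ℤ) →
    ∑ (λ S → ind d ∣ S ∣ * Z f S) ≡ + ((n ∸ k) C d) * ∑ f
  ∑-ind-Z {n} k d f supp = begin
    ∑ (λ S → ind d ∣ S ∣ * Z f S)
      ≡⟨ ∑-cong (λ S → sym (T-* disj (ind d ∣ S ∣) f S)) ⟩
    ∑ (λ S → Z (λ A → ind d ∣ S ∣ * f A) S)
      ≡⟨ ∑-transpose disj (λ S A → ind d ∣ S ∣ * f A) ⟩
    ∑ (λ A → T (disj ᵗ) (λ S → ind d ∣ S ∣ * f A) A)
      ≡⟨ ∑-cong (λ A → trans (disj-sym (λ S → ind d ∣ S ∣ * f A) A) (row A)) ⟩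
    ∑ (λ A → + ((n ∸ k) C d) * f A)
      ≡⟨ ∑-* (+ ((n ∸ k) C d)) f ⟩
    + ((n ∸ k) C d) * ∑ f ∎
    where
    open ≡-Reasoning
    disj-sym : ∀ {n} (g : Cube n) A → T (disj ᵗ) g A ≡ T disj g A
    disj-sym g []            = refl
    disj-sym g (outside ∷ A) = cong₂ _+_ (disj-sym (lo g) A) (disj-sym (hi g) A)
    disj-sym g (inside ∷ A)  = disj-sym (lo g) A
    row : ∀ A → Z (λ S → ind d ∣ S ∣ * f A) A ≡ + ((n ∸ k) C d) * f A
    row A = begin
      Z (λ S → ind d ∣ S ∣ * f A) A      ≡⟨ T-cong disj (λ S → ℤ.*-comm (ind d ∣ S ∣) (f A)) A ⟩
      Z (λ S → f A * ind d ∣ S ∣) A      ≡⟨ T-* disj (f A) (λ S → ind d ∣ S ∣) A ⟩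
      f A * Z (λ S → ind d ∣ S ∣) A      ≡⟨ cong (f A *_) (Z-ind d 0 A) ⟩
      f A * + ((n ∸ ∣ A ∣) C d)          ≡⟨ ℤ.*-comm (f A) (+ ((n ∸ ∣ A ∣) C d)) ⟩
      + ((n ∸ ∣ A ∣) C d) * f A          ≡⟨ at-k ⟩
      + ((n ∸ k) C d) * f A              ∎
      where
      at-k : + ((n ∸ ∣ A ∣) C d) * f A ≡ + ((n ∸ k) C d) * f A
      at-k with ∣ A ∣ ℕ.≟ k
      ... | yes A≡k = cong (λ a → + ((n ∸ a) C d) * f A) A≡k
      ... | no  A≢k = trans (cong (+ ((n ∸ ∣ A ∣) C d) *_) (supp A A≢k)) (trans (ℤ.*-zeroʳ (+ ((n ∸ ∣ A ∣) C d)))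
                      (sym (trans (cong (+ ((n ∸ k) C d) *_) (supp A A≢k)) (ℤ.*-zeroʳ (+ ((n ∸ k) C d))))))

  -- The bound on the minimum degree.

  module _ (n k d : ℕ) (d<k : d ℕ.< k) (2≤d : 2 ℕ.≤ d) (bound : 2 ℕ.* k ℕ.+ 2 ℕ.* d ℕ.≤ 3 ℕ.+ n)
           (F : Family n) (uniform : Uniform k F) (intersecting : Intersecting F) where

    open Coefficients n k d d<k 2≤d bound
    open Spectral n k d d<k 2≤d bound

    private
      f : Cube n
      f = χ F
      D₀ : ℕ
      D₀ = (n ∸ k) C d
      r₀ : ℕ
      r₀ = (n ∸ suc d) C (k ∸ suc d)

    weighted : L₀ ℕ.* (δ d F ℕ.* (D₀ ℕ.* size F)) ℕ.≤ c ℕ.* size F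
    weighted = ℤ.drop‿+≤+ (begin
      + (L₀ ℕ.* (δ d F ℕ.* (D₀ ℕ.* size F)))
        ≡⟨ trans (ℤ.pos-* L₀ (δ d F ℕ.* (D₀ ℕ.* size F))) (cong (+ L₀ *_) (trans (ℤ.pos-* (δ d F) (D₀ ℕ.* size F))
             (cong (+ δ d F *_) (trans (ℤ.pos-* D₀ (size F)) (cong (+ D₀ *_) (sym (χ-size F))))))) ⟩
      + L₀ * (+ δ d F * (+ D₀ * ∑ f))
        ≡⟨ cong (λ x → + L₀ * (+ δ d F * x)) (∑-ind-Z k d f (χ-support F uniform)) ⟨
      + L₀ * (+ δ d F * ∑ (λ S → ind d ∣ S ∣ * Z f S))
        ≡⟨ cong (+ L₀ *_) (∑-* (+ δ d F) (λ S → ind d ∣ S ∣ * Z f S)) ⟨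
      + L₀ * ∑ (λ S → + δ d F * (ind d ∣ S ∣ * Z f S))
        -- The weights Z f S are nonnegative, so each degree may be bounded below by the minimum
        -- degree.
        ≤⟨ ℤ.*-monoˡ-≤-nonNeg (+ L₀) (∑-mono pointwise-δ) ⟩
      + L₀ * ∑ (λ S → ind d ∣ S ∣ * (Y f S * Z f S))
        ≤⟨ spectral f (χ-support F uniform) ⟩
      + c * ∑ (λ S → f S * f S) + + L * ∑ (λ S → f S * Z f S)
        -- As f takes the values 0 and 1, ⟨f, f⟩ is the size of F, and ⟨f, Z f⟩ is zero because F is
        -- intersecting.
        ≡⟨ cong₂ (λ x y → + c * x + + L * y) (trans (∑-cong (χ-square F)) (χ-size F))
                 (trans (∑-cong (χ-Z F intersecting)) (∑-0 n)) ⟩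
      + c * + size F + + L * 0ℤ
        ≡⟨ trans (cong (λ x → + c * + size F + x) (ℤ.*-zeroʳ (+ L))) (ℤ.+-identityʳ (+ c * + size F)) ⟩
      + c * + size F
        ≡⟨ ℤ.pos-* c (size F) ⟨
      + (c ℕ.* size F) ∎)
      where
      open ℤ.≤-Reasoning
      pointwise-δ : ∀ S → + δ d F * (ind d ∣ S ∣ * Z f S) ≤ ind d ∣ S ∣ * (Y f S * Z f S)
      pointwise-δ S with ∣ S ∣ ℕ.≟ d
      ... | yes refl rewrite ind-refl ∣ S ∣ | ℤ.*-identityˡ (Z f S) | ℤ.*-identityˡ (Y f S * Z f S) | χ-degree F S =
        ℤ.*-monoʳ-≤-nonNeg (Z f S) {{nonNegative (Z-nonneg f S (χ-nonneg F))}} (+≤+ (δ≤degree F S))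
      ... | no  S≢d rewrite ind-≢ {d} {∣ S ∣} (S≢d ∘ sym) = ℤ.≤-reflexive (ℤ.*-zeroʳ (+ δ d F))

    -- `c` is `L₀ * (D₀ * r₀)`, so for m > 0 the positive factor `L₀ * (D₀ * m)` cancels; for m = 0
    -- the assumption x ≤ m suffices.
    cancel-size : ∀ m x → x ℕ.≤ m → L₀ ℕ.* (x ℕ.* (D₀ ℕ.* m)) ℕ.≤ c ℕ.* m → x ℕ.≤ r₀
    cancel-size zero    x x≤m _  = ℕ.≤-trans x≤m z≤n
    cancel-size (suc m) x _   le = ℕ.*-cancelˡ-≤ (L₀ ℕ.* (D₀ ℕ.* suc m)) {{nz}} (begin
      L₀ ℕ.* (D₀ ℕ.* suc m) ℕ.* x        ≡⟨ r₁ L₀ D₀ (suc m) x ⟩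
      L₀ ℕ.* (x ℕ.* (D₀ ℕ.* suc m))      ≤⟨ le ⟩
      L₀ ℕ.* (D₀ ℕ.* r₀) ℕ.* suc m       ≡⟨ r₂ L₀ D₀ r₀ (suc m) ⟩
      L₀ ℕ.* (D₀ ℕ.* suc m) ℕ.* r₀       ∎)
      where
      open ℕ.≤-Reasoning
      r₁ : ∀ l c m x → l ℕ.* (c ℕ.* m) ℕ.* x ≡ l ℕ.* (x ℕ.* (c ℕ.* m))
      r₁ = ℕ-Solver.solve-∀
      r₂ : ∀ l c r m → l ℕ.* (c ℕ.* r) ℕ.* m ≡ l ℕ.* (c ℕ.* m) ℕ.* r
      r₂ = ℕ-Solver.solve-∀
      C≢0 : ∀ l → l ℕ.≤ k → NonZero ((n ∸ k) C l)
      C≢0 l l≤k = ℕ.>-nonZero (subst (λ x → 0 ℕ.< x C l) (ℕ.m∸n+n≡m (ℕ.≤-trans l≤k k≤n∸k)) (C>0 (n ∸ k ∸ l) l))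
        where
        k≤n∸k : k ℕ.≤ n ∸ k
        k≤n∸k = subst (ℕ._≤ n ∸ k) (ℕ.m+n∸m≡n k k) (ℕ.∸-monoˡ-≤ k 2k≤n)
      nz : NonZero (L₀ ℕ.* (D₀ ℕ.* suc m))
      nz = ℕ.m*n≢0 L₀ (D₀ ℕ.* suc m) {{C≢0 k ℕ.≤-refl}} {{ℕ.m*n≢0 D₀ (suc m) {{C≢0 d (ℕ.<⇒≤ d<k)}}}}

    degree-bound : δ d F ℕ.≤ r₀
    degree-bound = cancel-size (size F) (δ d F) (δ≤size d F) weighted

open import Data.Nat.Base using (ℕ; _+_; _*_; _∸_; _≤_; _≥_; _>_)
open import Data.Nat.Combinatorics using (_C_)

theorem1p1 : ∀ (n k d : ℕ) → k > d → d ≥ 2 → n ≥ 2 * k + 2 * d ∸ 3 →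
    (F : Family n) → Uniform k F → Intersecting F →
    δ d F ≤ (n ∸ d ∸ 1) C (k ∸ d ∸ 1)
theorem1p1 n k d d<k 2≤d bound F uniform intersecting =
  subst₂ (λ x y → δ d F ≤ x C y) (∸-suc n) (∸-suc k)
    (degree-bound n k d d<k 2≤d
      -- Trades the truncated subtraction in the hypothesis on n for an addition, by m ≤ 3 + (m ∸
      -- 3).
      (ℕ.≤-trans (ℕ.m≤n+m∸n (2 * k + 2 * d) 3) (ℕ.+-monoʳ-≤ 3 bound)) F uniform intersecting)
  where
  ∸-suc : ∀ m → m ∸ suc d ≡ m ∸ d ∸ 1
  ∸-suc m = trans (cong (m ∸_) (ℕ.+-comm 1 d)) (sym (ℕ.∸-+-assoc m d 1))
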